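{- The Ehrhart polynomial of the polytope $\mathcal{P}(F)$, where $F$ is a forest on the vertex set $[n+1]$ with $l$ edges, is $$L_{\mathcal{P}(F)}(t)=(-1)^l\sum_{i=0}^l(-1)^i f_{F,i}\binom{t+i}{i},$$ where $f_{F,k}$ is the number of leaves of an $\mathcal{S}$-reduction tree $\mathcal{T}_F^{\mathcal{S}}$ with root labeled $F$ that are labeled by forests with $k$ edges.
   Context: Graphs have vertex set $[n+1]=\{1,\ldots,n+1\}$; an edge joining $i<j$ is written $(i,j)$. Let $e_1,\ldots,e_{n+1}$ be the coordinate vectors of $\mathbb{R}^{n+1}$. $\mathcal{P}(A_n^+)$ is the convex hull of the origin and the points $e_i-e_j$, $1\le i<j\le n+1$; $\mathcal{C}(G)$ is the cone of nonnegative combinations of the $e_i-e_j$ with $(i,j)\in E(G)$, $i<j$; and $\mathcal{P}(G)=\mathcal{P}(A_n^+)\cap\mathcal{C}(G)$. The Ehrhart polynomial of an integer polytope $\mathcal{P}\subset\mathbb{R}^{n+1}$ is $L_{\mathcal{P}}(t)=\#(t\mathcal{P}\cap\mathbb{Z}^{n+1})$, where $t\mathcal{P}=\{tx\mid x\in\mathcal{P}\}$. Reduction rule for graphs: given $G_0$ with $(i,j),(j,k)\in E(G_0)$, $i<j<k$, $G_0$ reduces to $G_1,G_2,G_3$ with $E(G_1)=E(G_0)\setminus\{(j,k)\}\cup\{(i,k)\}$, $E(G_2)=E(G_0)\setminus\{(i,j)\}\cup\{(i,k)\}$, $E(G_3)=E(G_0)\setminus\{(i,j)\}\setminus\{(j,k)\}\cup\{(i,k)\}$.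 An $\mathcal{S}$-reduction tree with root labeled $F$ is a rooted tree with nodes labeled by graphs, with root labeled $F$, in which every node whose label admits a reduction has three children labeled by the graphs $G_1,G_2,G_3$ resulting from one chosen reduction of it, and whose leaves are labeled by graphs to which no reduction can be applied. The number $f_{F,k}$ does not depend on the choice of the $\mathcal{S}$-reduction tree. -}

module Defs where

open import Algebra.Apartness.Bundles using (HeytingField; HeytingCommutativeRing)
open import Algebra.Bundles using (CommutativeRing)
import Algebra.Definitions.RawMonoid as RawMonoidDefs
open import Data.Bool.Base using (if_then_else_)
open import Data.Fin.Base as Fin using (Fin; zero; suc; inject₁; fromℕ; fromℕ<; toℕ)
import Data.Fin.Properties as Fin
open import Data.Integer.Base as ℤ using (ℤ; +_; -[1+_])
import Data.Integer.Properties as ℤ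
open import Data.List.Base using (List; _∷_; _++_; [_]; map; filter; length; lookup; allFin; cartesianProduct)
open import Data.List.Membership.Propositional using (_∈_)
open import Data.List.Relation.Unary.Unique.Propositional using (Unique)
open import Data.Nat.Base as ℕ using (ℕ; zero; suc)
import Data.Nat.Properties as ℕ
open import Data.Product.Base using (∃; _×_; _,_)
open import Data.Product.Properties using (≡-dec)
import Data.Rational.Unnormalised.Base as ℚᵘ
import Data.Rational.Unnormalised.Properties as ℚᵘ
open import Data.Sum.Base using (_⊎_; inj₁; inj₂)
open import Data.Vec.Base as Vec using (Vec; []; _∷_)
open import Data.Vec.Functional using (Vector)
open import Function.Base using (_∘_)
open import Function.Bundles using (_⇔_)
open import Level using (Level; 0ℓ; _⊔_) renaming (suc to lsuc)
open import Relation.Binary.Core using (Rel)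
open import Relation.Binary.Definitions using (DecidableEquality; tri<; tri≈; tri>)
open import Relation.Binary.PropositionalEquality.Core using (_≡_; refl; sym; subst)
open import Relation.Binary.Structures using (IsStrictPartialOrder)
open import Relation.Nullary.Decidable using (Dec; does; map′; ¬?; _×-dec_; _⊎-dec_; _→-dec_)
open import Relation.Nullary.Negation using (¬_; contradiction)
open import Relation.Unary using (Pred; Decidable; _∪_; _∩_; _∖_; ｛_｝)
open import Relation.Unary.Properties using (_∪?_)

private
  variable
    a p c ℓ₁ ℓ₂ ℓ₃ : Level
    n : ℕ

------------------------------------------------------------------------
-- Graphs on [n+1]

Vertex : ℕ → Set
Vertex n = Fin (suc n)

Edge : ℕ → Set
Edge n = Vertex n × Vertex n

record Graph (n : ℕ) : Set₁ where
  field
    E   : Pred (Edge n) 0ℓ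
    E?  : Decidable E
    E-< : ∀ {i j} → E (i , j) → i Fin.< j

open Graph public

edges : Graph n → List (Edge n)
edges {n} G = filter (E? G) (cartesianProduct (allFin (suc n)) (allFin (suc n)))

numEdges : Graph n → ℕ
numEdges G = length (edges G)

complete : ∀ n → Graph n
complete n = record
  { E   = λ (i , j) → i Fin.< j
  ; E?  = λ (i , j) → i Fin.<? j
  ; E-< = λ i<j → i<j
  }

------------------------------------------------------------------------
-- Forests

Adjacent : Graph n → Vertex n → Vertex n → Set
Adjacent G i j = E G (i , j) ⊎ E G (j , i)

IsCycle : (G : Graph n) {m : ℕ} → Vec (Vertex n) (3 ℕ.+ m) → Set
IsCycle G {m} v =
    (∀ i j → Vec.lookup v i ≡ Vec.lookup v j → i ≡ j)
  × (∀ (i : Fin (2 ℕ.+ m)) → Adjacent G (Vec.lookup v (inject₁ i)) (Vec.lookup v (suc i)))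
  × Adjacent G (Vec.lookup v (fromℕ (2 ℕ.+ m))) (Vec.lookup v zero)

Cycle : Graph n → Set
Cycle {n} G = ∃ λ m → ∃ λ (v : Vec (Vertex n) (3 ℕ.+ m)) → IsCycle G v

IsForest : Graph n → Set
IsForest G = ¬ Cycle G

adjacent? : (G : Graph n) (i j : Vertex n) → Dec (Adjacent G i j)
adjacent? G i j = E? G (i , j) ⊎-dec E? G (j , i)

isCycle? : (G : Graph n) {m : ℕ} (v : Vec (Vertex n) (3 ℕ.+ m)) → Dec (IsCycle G v)
isCycle? G v =
        Fin.all? (λ i → Fin.all? λ j →
          (Vec.lookup v i Fin.≟ Vec.lookup v j) →-dec (i Fin.≟ j))
  ×-dec Fin.all? (λ i → adjacent? G _ _)
  ×-dec adjacent? G _ _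

anyVec? : ∀ {k} m {P : Pred (Vec (Fin k) m) p} → Decidable P → Dec (∃ P)
anyVec? zero    P? = map′ ([] ,_) (λ { ([] , q) → q }) (P? [])
anyVec? (suc m) P? =
  map′ (λ (x , xs , q) → x ∷ xs , q) (λ { (x ∷ xs , q) → x , xs , q })
       (Fin.any? λ x → anyVec? m (P? ∘ (x ∷_)))

-- A cycle has at most n + 1 vertices, so the search over its length is bounded.
cycle? : (G : Graph n) → Dec (Cycle G)
cycle? {n} G = map′ (λ (m , c) → toℕ m , c) bounded
  (Fin.any? {n = suc n} λ m → anyVec? (3 ℕ.+ toℕ m) (isCycle? G))
  where
  CycleOf : ℕ → Set
  CycleOf m = ∃ λ (v : Vec (Vertex n) (3 ℕ.+ m)) → IsCycle G v

  bounded : Cycle G → ∃ λ (m : Fin (suc n)) → CycleOf (toℕ m)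
  bounded (m , v , c@(inj , _)) =
    fromℕ< m<1+n , subst CycleOf (sym (Fin.toℕ-fromℕ< m<1+n)) (v , c)
    where
    m<1+n : m ℕ.< suc n
    m<1+n = ℕ.≤-trans (ℕ.m≤n+m (suc m) 2)
      (Fin.injective⇒≤ {f = Vec.lookup v} (λ {i} {j} → inj i j))

isForest? : (G : Graph n) → Dec (IsForest G)
isForest? G = ¬? (cycle? G)

------------------------------------------------------------------------
-- Reductions and 𝒮-reduction trees

infix 4 _≟ₑ_

_≟ₑ_ : DecidableEquality (Edge n)
_≟ₑ_ = ≡-dec Fin._≟_ Fin._≟_

record Reduction (G : Graph n) : Set where
  field
    {i j k} : Vertex n
    ij∈E    : E G (i , j)
    jk∈E    : E G (j , k)

  i<k : i Fin.< k
  i<k = Fin.<-trans (E-< G ij∈E) (E-< G jk∈E)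

  private
    _∖?_ : {P : Pred (Edge n) 0ℓ} → Decidable P → ∀ e → Decidable (P ∖ ｛ e ｝)
    (P? ∖? e) x = P? x ×-dec ¬? (e ≟ₑ x)

  G₁ G₂ G₃ : Graph n
  G₁ = record
    { E   = (E G ∖ ｛ j , k ｝) ∪ ｛ i , k ｝
    ; E?  = (E? G ∖? (j , k)) ∪? ((i , k) ≟ₑ_)
    ; E-< = λ { (inj₁ (e , _)) → E-< G e ; (inj₂ refl) → i<k }
    }
  G₂ = record
    { E   = (E G ∖ ｛ i , j ｝) ∪ ｛ i , k ｝
    ; E?  = (E? G ∖? (i , j)) ∪? ((i , k) ≟ₑ_)
    ; E-< = λ { (inj₁ (e , _)) → E-< G e ; (inj₂ refl) → i<k }
    }
  G₃ = record
    { E   = ((E G ∖ ｛ i , j ｝) ∖ ｛ j , k ｝) ∪ ｛ i , k ｝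
    ; E?  = ((E? G ∖? (i , j)) ∖? (j , k)) ∪? ((i , k) ≟ₑ_)
    ; E-< = λ { (inj₁ ((e , _) , _)) → E-< G e ; (inj₂ refl) → i<k }
    }

open Reduction public using (G₁; G₂; G₃)

data STree {n} (G : Graph n) : Set₁ where
  leaf : ¬ Reduction G → STree G
  node : (r : Reduction G) → STree (G₁ r) → STree (G₂ r) → STree (G₃ r) → STree G

leaves : {G : Graph n} → STree G → List (Graph n)
leaves {G = G} (leaf _)         = [ G ]
leaves         (node _ T₁ T₂ T₃) = leaves T₁ ++ leaves T₂ ++ leaves T₃

-- f_{G,k}, computed from a given 𝒮-reduction tree of G.
f : {G : Graph n} → STree G → ℕ → ℕ
f T k = length (filter (λ H → isForest? H ×-dec (numEdges H ℕ.≟ k)) (leaves T))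

------------------------------------------------------------------------
-- The field of scalars

-- The order axioms are chosen so that classical and constructive real numbers
-- are both instances: no trichotomy or decidability of < is assumed.
record OrderedField c ℓ₁ ℓ₂ ℓ₃ : Set (lsuc (c ⊔ ℓ₁ ⊔ ℓ₂ ⊔ ℓ₃)) where
  infix 4 _<_ _≤_
  field
    heytingField : HeytingField c ℓ₁ ℓ₂

  open HeytingField heytingField public
  open HeytingCommutativeRing heytingCommutativeRing public using (commutativeRing)
  open CommutativeRing commutativeRing public using (+-rawMonoid)

  field
    _<_                    : Rel Carrier ℓ₃
    <-isStrictPartialOrder : IsStrictPartialOrder _≈_ _<_
    #⇒<⊎>                  : ∀ {x y} → x # y → x < y ⊎ y < x
    <⇒#                    : ∀ {x y} → x < y → x # y
    +-monoˡ-<              : ∀ z {x y} → x < y → x + z < y + z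
    *-pos                  : ∀ {x y} → 0# < x → 0# < y → 0# < x * y

  _≤_ : Rel Carrier ℓ₃
  x ≤ y = ¬ (y < x)

ℚ-orderedField : OrderedField 0ℓ 0ℓ 0ℓ 0ℓ
ℚ-orderedField = record
  { heytingField           = ℚᵘ.+-*-heytingField
  ; _<_                    = ℚᵘ._<_
  ; <-isStrictPartialOrder = ℚᵘ.<-isStrictPartialOrder
  ; #⇒<⊎>                  = λ {x} {y} → ≄⇒<⊎> x y
  ; <⇒#                    = λ {x} {y} x<y x≃y → ℚᵘ.<-irrefl x≃y x<y
  ; +-monoˡ-<              = λ z → ℚᵘ.+-monoˡ-< z
  ; *-pos                  = λ {x} {y} 0<x 0<y → ℚᵘ.positive⁻¹ (x ℚᵘ.* y)
      {{ℚᵘ.pos*pos⇒pos x {{ℚᵘ.positive 0<x}} y {{ℚᵘ.positive 0<y}}}}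
  }
  where
  ≄⇒<⊎> : ∀ x y → x ℚᵘ.≄ y → x ℚᵘ.< y ⊎ y ℚᵘ.< x
  ≄⇒<⊎> x y x≄y with ℚᵘ.<-cmp x y
  ... | tri< x<y _ _ = inj₁ x<y
  ... | tri≈ _ x≃y _ = contradiction x≃y x≄y
  ... | tri> _ _ y<x = inj₂ y<x

------------------------------------------------------------------------
-- Polytopes, cones and lattice points

HasCardinality : {A : Set a} → Pred A p → ℕ → Set (a ⊔ p)
HasCardinality {A = A} P m =
  ∃ λ (xs : List A) → Unique xs × (∀ x → x ∈ xs ⇔ P x) × length xs ≡ m

module Polytopes (K : OrderedField c ℓ₁ ℓ₂ ℓ₃) where
  open OrderedField K
  open RawMonoidDefs +-rawMonoid using (sum) renaming (_×_ to _·_)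

  fromℤ : ℤ → Carrier
  fromℤ (+ m)    = m · 1#
  fromℤ -[1+ m ] = - (suc m · 1#)

  Point : ℕ → Set c
  Point n = Vector Carrier (suc n)

  combination : ∀ {m} → Vector Carrier m → Vector (Point n) m → Point n
  combination c v x = sum λ s → c s * v s x

  Cone : ∀ {m} → Vector (Point n) m → Pred (Point n) _
  Cone v y = ∃ λ c → (∀ s → 0# ≤ c s) × (∀ x → y x ≈ combination c v x)

  ConvexHull : ∀ {m} → Vector (Point n) m → Pred (Point n) _
  ConvexHull v y = ∃ λ c →
    (∀ s → 0# ≤ c s) × (sum c ≈ 1#) × (∀ x → y x ≈ combination c v x)

  origin : Point n
  origin _ = 0#

  basis : Vertex n → Point n
  basis i x = if does (i Fin.≟ x) then 1# else 0#

  root : Edge n → Point n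
  root (i , j) x = basis i x - basis j x

  𝒫[A⁺] : ∀ n → Pred (Point n) _
  𝒫[A⁺] n = ConvexHull (lookup (origin ∷ map root (edges (complete n))))

  𝒞 : Graph n → Pred (Point n) _
  𝒞 G = Cone (lookup (map root (edges G)))

  𝒫 : Graph n → Pred (Point n) _
  𝒫 {n} G = 𝒫[A⁺] n ∩ 𝒞 G

  dilate : ℕ → Pred (Point n) p → Pred (Point n) _
  dilate t P y = ∃ λ x → P x × (∀ s → y s ≈ fromℤ (+ t) * x s)

  LatticePoint : Pred (Point n) p → Pred (Vec ℤ (suc n)) p
  LatticePoint P z = P (λ x → fromℤ (Vec.lookup z x))

  HasEhrhartFunction : Pred (Point n) p → (ℕ → ℤ) → Set _
  HasEhrhartFunction P L =
    ∀ t → ∃ λ m → HasCardinality (LatticePoint (dilate t P)) m × + m ≡ L t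

------------------------------------------------------------------------
-- Integer sums

open RawMonoidDefs ℤ.+-0-rawMonoid public using () renaming (sum to sumℤ)

{-# OPTIONS --safe #-}

-- A reduction splits the cone 𝒞(G₀) into 𝒞(G₁) and 𝒞(G₂), which meet in 𝒞(G₃); on
-- lattice points this gives an inclusion-exclusion along the reduction tree.  At a leaf
-- every vertex is a source or a sink, so a point of the cone lies in t𝒫(Aₙ⁺) exactly when
-- the sum of its coefficients is at most t.  The edge vectors of a forest form a
-- unimodular set, so the points at a leaf with k edges correspond to the k-tuples of
-- naturals with sum at most t, of which there are C(t + k, k).
module Submission where

open import Defs
open import Algebra.Apartness.Properties.HeytingCommutativeRing using (invertibleˡ⇒#; x-0≈x; 1#0)
open import Algebra.Bundles using (CommutativeRing)
open import Data.Bool.Base using (Bool; true; false; if_then_else_)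
open import Data.Empty using (⊥)
open import Data.Fin.Base as Fin using (Fin; zero; suc; toℕ; inject₁; fromℕ; fromℕ<)
import Data.Fin.Properties as Fin
open import Data.Integer.Base as ℤ
  using (ℤ; +_; -[1+_]; 0ℤ; 1ℤ; -1ℤ; +≤+; -≤+; _⊖_; nonNegative)
import Data.Integer.Properties as ℤ
open import Data.Integer.Tactic.RingSolver using (solve-∀)
open import Data.List.Base as List
  using (List; []; _∷_; _++_; [_]; map; filter; foldr; length; allFin; cartesianProduct)
import Data.List.Membership.DecPropositional as DecMembership
open import Data.List.Membership.Propositional using (_∈_; _∉_)
open import Data.List.Membership.Propositional.Properties
  using (∈-++⁺ˡ; ∈-++⁺ʳ; ∈-++⁻; ∈-map⁺; ∈-map⁻; ∈-filter⁺; ∈-filter⁻; ∈-cartesianProduct⁺; ∈-allFin)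
open import Data.List.Membership.Propositional.Properties.WithK using (unique∧set⇒bag)
open import Data.List.Properties using (length-++; length-map)
open import Data.List.Relation.Binary.BagAndSetEquality using (∼bag⇒↭)
open import Data.List.Relation.Binary.Permutation.Propositional.Properties using (↭-length)
open import Data.List.Relation.Unary.All as All using (All; []; _∷_)
import Data.List.Relation.Unary.All.Properties as All
open import Data.List.Relation.Unary.AllPairs using ([]; _∷_)
open import Data.List.Relation.Unary.Any using (here; there)
open import Data.List.Relation.Unary.Unique.Propositional using (Unique)
import Data.List.Relation.Unary.Unique.Propositional.Properties as Unique
open import Data.Nat.Base as ℕ using (ℕ; zero; suc) renaming (_+_ to _+ₙ_)
open import Data.Nat.Combinatorics using (_C_; nCn≡1; nCk+nC[k+1]≡[n+1]C[k+1])
import Data.Nat.Properties as ℕ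
open import Data.Product.Base as Product using (Σ; ∃; ∃₂; _×_; _,_; proj₁; proj₂)
open import Data.Sum.Base as Sum using (_⊎_; inj₁; inj₂; [_,_]′)
open import Data.Vec.Base as Vec using (Vec; []; _∷_; tabulate; replicate)
open import Data.Vec.Functional using (Vector)
open import Data.Vec.Properties
  using (lookup∘tabulate; tabulate∘lookup; tabulate-cong; lookup-replicate; ≡-dec)
open import Function.Base using (_∘_)
open import Function.Bundles using (_⇔_; mk⇔; module Equivalence)
open import Function.Construct.Composition using (_⇔-∘_)
open import Function.Construct.Symmetry using (⇔-sym)
open import Level using (Level; _⊔_)
open import Relation.Binary.Construct.Closure.Equivalence as EqClosure using (EqClosure)
open import Relation.Binary.Construct.Closure.ReflexiveTransitive using (Star; ε; _◅_; _◅◅_)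
open import Relation.Binary.Construct.Closure.Symmetric using (SymClosure; fwd; bwd)
open import Relation.Binary.Core using (Rel)
open import Relation.Binary.Definitions using (DecidableEquality)
open import Relation.Binary.PropositionalEquality as ≡ using (_≡_; _≢_; module ≡-Reasoning)
open import Relation.Binary.Structures using (IsStrictPartialOrder)
open import Relation.Nullary.Decidable as Dec
  using (yes; no; does; dec-true; dec-false; ¬?; _×-dec_)
open import Relation.Nullary.Negation using (¬_; contradiction)
open import Relation.Unary using (Pred; Decidable; _∪_; _∩_; _∖_; ｛_｝)

open Equivalence using (to; from)

-- At an inner node the bound cannot be put on the coefficients: over the edges (1,2), (2,3) the
-- root e_1 - e_3 has coefficients of sum 2, although it lies in the polytope of Aₙ⁺. It is replaced
-- by linear inequalities on the point alone, one for each set of vertices (`Within`). They are the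
-- same for every graph of the tree, so they pass through inclusion-exclusion unchanged. Points of
-- the dilated polytope satisfy them; the converse is read off at a leaf and holds for every point
-- that reaches the leaf from the root (`short`).
--
-- Being a forest is used as the solvability of ∂φ = w for every integral weight w on the edges. In
-- this form it passes to the reduced graphs by a change of w at one edge. Moreover, a potential of
-- the indicator of an edge reads the coefficient of that edge off the point. This gives uniqueness
-- of coefficients and, since the potential is integral, their integrality over any field of
-- scalars.
--
-- The order of the scalars need not be decidable, so the counting is done entirely over the
-- integers; the field enters only when `LatticeSet` is compared with the lattice points of the
-- polytope.

private
  variable
    a p q : Level
    A : Set a
    n : ℕ

-- Sums over vertices and edges; boundary and coboundary of a graph

module EdgeSums {c ℓ} (R : CommutativeRing c ℓ) where
  open CommutativeRing R hiding (zero)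
  open import Algebra.Properties.Semiring.Sum semiring
    using (sum; sum-cong-≋; sum-replicate-zero; ∑-distrib-+; ∑-comm; *-distribˡ-sum)
  open import Algebra.Properties.Ring ring
    using (x[y-z]≈xy-xz; -‿+-comm; -0#≈0#)
  open import Algebra.Properties.CommutativeSemigroup *-commutativeSemigroup
    using (x∙yz≈y∙xz)
  open import Relation.Binary.Reasoning.Setoid setoid

  -- Sums are opaque, because over a nonempty index type the fold unfolds and the
  -- summand can no longer be inferred.
  opaque
    ∑ : ∀ {m} → (Fin m → Carrier) → Carrier
    ∑ = sum

    ∑≡sum : ∀ {m} (g : Fin m → Carrier) → ∑ g ≡ sum g
    ∑≡sum g = ≡.refl

    ∑-cong : ∀ {m} {g h : Fin m → Carrier} → (∀ i → g i ≈ h i) → ∑ g ≈ ∑ h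
    ∑-cong = sum-cong-≋

    ∑-zero : ∀ {m} {g : Fin m → Carrier} → (∀ i → g i ≈ 0#) → ∑ g ≈ 0#
    ∑-zero {m} g≈0 = trans (∑-cong g≈0) (sum-replicate-zero m)

    ∑-single : ∀ {m} (i : Fin m) {g : Fin m → Carrier} →
               (∀ j → i ≢ j → g j ≈ 0#) → ∑ g ≈ g i
    ∑-single zero    g≈0 =
      trans (+-congˡ (∑-zero λ j → g≈0 (suc j) λ ())) (+-identityʳ _)
    ∑-single (suc i) g≈0 =
      trans (+-cong (g≈0 zero λ ())
                    (∑-single i λ j i≢j → g≈0 (suc j) (i≢j ∘ Fin.suc-injective)))
            (+-identityˡ _)

    ∑-+ : ∀ {m} (g h : Fin m → Carrier) → ∑ (λ i → g i + h i) ≈ ∑ g + ∑ h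
    ∑-+ = ∑-distrib-+

    ∑-neg : ∀ {m} (g : Fin m → Carrier) → ∑ (λ i → - g i) ≈ - ∑ g
    ∑-neg {zero}  g = sym -0#≈0#
    ∑-neg {suc m} g = trans (+-congˡ (∑-neg (g ∘ suc))) (-‿+-comm _ _)

    *-∑ : ∀ {m} x (g : Fin m → Carrier) → x * ∑ g ≈ ∑ (λ i → x * g i)
    *-∑ = *-distribˡ-sum

    ∑-swap : ∀ {m k} (g : Fin m → Fin k → Carrier) →
             ∑ (λ i → ∑ (g i)) ≈ ∑ (λ j → ∑ λ i → g i j)
    ∑-swap = ∑-comm

    -- The relation is a parameter because the ring carries no order: it is used with the order of
    -- the integers and with the negated strict order of the field.
    ∑-mono : ∀ {ℓ′} (_≤_ : Rel Carrier ℓ′) → 0# ≤ 0# →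
             (∀ {w x y z} → w ≤ x → y ≤ z → (w + y) ≤ (x + z)) →
             ∀ {m} {g h : Fin m → Carrier} → (∀ i → g i ≤ h i) → ∑ g ≤ ∑ h
    ∑-mono _≤_ base step {zero}  g≤h = base
    ∑-mono _≤_ base step {suc m} g≤h = step (g≤h zero) (∑-mono _≤_ base step (g≤h ∘ suc))

  opaque
    -- Runs over all pairs of vertices instead of the edges of one graph, so that coefficients for
    -- different graphs have the same type and can be compared.
    ∑ₑ : (Edge n → Carrier) → Carrier
    ∑ₑ g = ∑ λ a → ∑ λ b → g (a , b)

    ∑ₑ≡∑∑ : (g : Edge n → Carrier) → ∑ₑ g ≡ ∑ λ a → ∑ λ b → g (a , b)
    ∑ₑ≡∑∑ g = ≡.refl

    ∑ₑ-cong : {g h : Edge n → Carrier} → (∀ e → g e ≈ h e) → ∑ₑ g ≈ ∑ₑ h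
    ∑ₑ-cong g≈h = ∑-cong λ a → ∑-cong λ b → g≈h (a , b)

    ∑ₑ-+ : (g h : Edge n → Carrier) → ∑ₑ (λ e → g e + h e) ≈ ∑ₑ g + ∑ₑ h
    ∑ₑ-+ g h = trans (∑-cong λ a → ∑-+ _ _) (∑-+ _ _)

    *-∑ₑ : ∀ x (g : Edge n → Carrier) → x * ∑ₑ g ≈ ∑ₑ (λ e → x * g e)
    *-∑ₑ x g = trans (*-∑ x _) (∑-cong λ a → *-∑ x _)

    ∑ₑ-single : ∀ e {g : Edge n → Carrier} → (∀ e′ → e ≢ e′ → g e′ ≈ 0#) → ∑ₑ g ≈ g e
    ∑ₑ-single (i , j) g≈0 =
      trans (∑-single i λ a i≢a → ∑-zero λ b → g≈0 (a , b) (i≢a ∘ ≡.cong proj₁))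
            (∑-single j λ b j≢b → g≈0 (i , b) (j≢b ∘ ≡.cong proj₂))

    ∑-∑ₑ-swap : ∀ {m} (g : Fin m → Edge n → Carrier) →
                ∑ (λ v → ∑ₑ (g v)) ≈ ∑ₑ (λ e → ∑ λ v → g v e)
    ∑-∑ₑ-swap g = trans (∑-swap _) (∑-cong λ a → ∑-swap _)

    ∑ₑ-mono : ∀ {ℓ′} (_≤_ : Rel Carrier ℓ′) → 0# ≤ 0# →
              (∀ {w x y z} → w ≤ x → y ≤ z → (w + y) ≤ (x + z)) →
              {g h : Edge n → Carrier} → (∀ e → g e ≤ h e) → ∑ₑ g ≤ ∑ₑ h
    ∑ₑ-mono _≤_ base step g≤h =
      ∑-mono _≤_ base step λ a → ∑-mono _≤_ base step λ b → g≤h (a , b)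

  single : Edge n → Carrier → Edge n → Carrier
  single e x e′ = if does (e ≟ₑ e′) then x else 0#

  single-same : ∀ (e : Edge n) x → single e x e ≡ x
  single-same e x rewrite dec-true (e ≟ₑ e) ≡.refl = ≡.refl

  single-other : ∀ {e e′ : Edge n} x → e ≢ e′ → single e x e′ ≡ 0#
  single-other {e = e} {e′} x e≢e′ rewrite dec-false (e ≟ₑ e′) e≢e′ = ≡.refl

  -- `basis` and `root` are restated for any commutative ring, so that integral and field-valued
  -- combinations share one calculus. Over the field they unfold to the same terms as in
  -- `Polytopes`.
  basis : Vertex n → Vertex n → Carrier
  basis i x = if does (i Fin.≟ x) then 1# else 0#

  root : Edge n → Vertex n → Carrier
  root (i , j) x = basis i x - basis j x

  ∂ : (Vertex n → Carrier) → Edge n → Carrier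
  ∂ φ (i , j) = φ i - φ j

  opaque
    ⟪_,_⟫ : (Edge n → Carrier) → (Edge n → Carrier) → Carrier
    ⟪ c , g ⟫ = ∑ₑ λ e → c e * g e

    ⟪⟫≡∑ₑ : (c g : Edge n → Carrier) → ⟪ c , g ⟫ ≡ ∑ₑ λ e → c e * g e
    ⟪⟫≡∑ₑ c g = ≡.refl

    ⟪⟫-cong : {c d g h : Edge n → Carrier} →
              (∀ e → c e * g e ≈ d e * h e) → ⟪ c , g ⟫ ≈ ⟪ d , h ⟫
    ⟪⟫-cong = ∑ₑ-cong

    ⟪⟫-+ : (c d g : Edge n → Carrier) →
           ⟪ (λ e → c e + d e) , g ⟫ ≈ ⟪ c , g ⟫ + ⟪ d , g ⟫
    ⟪⟫-+ c d g = trans (∑ₑ-cong λ e → distribʳ (g e) (c e) (d e)) (∑ₑ-+ _ _)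

    ⟪⟫-single : ∀ e x (g : Edge n → Carrier) → ⟪ single e x , g ⟫ ≈ x * g e
    ⟪⟫-single e x g =
      trans (∑ₑ-single e λ e′ e≢e′ →
               trans (*-congʳ (reflexive (single-other x e≢e′))) (zeroˡ (g e′)))
            (*-congʳ (reflexive (single-same e x)))

    ⟪⟫-* : ∀ x (c g : Edge n → Carrier) → ⟪ (λ e → x * c e) , g ⟫ ≈ x * ⟪ c , g ⟫
    ⟪⟫-* x c g = trans (∑ₑ-cong λ e → *-assoc x (c e) (g e)) (sym (*-∑ₑ x _))

    ⟪⟫-1 : (c : Edge n → Carrier) → ⟪ c , (λ _ → 1#) ⟫ ≈ ∑ₑ c
    ⟪⟫-1 c = ∑ₑ-cong λ e → *-identityʳ (c e)

    ⟪⟫-comm : (c g : Edge n → Carrier) → ⟪ c , g ⟫ ≈ ⟪ g , c ⟫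
    ⟪⟫-comm c g = ∑ₑ-cong λ e → *-comm (c e) (g e)

  ⟪⟫-congˡ : {c d : Edge n → Carrier} (g : Edge n → Carrier) →
             (∀ e → c e ≈ d e) → ⟪ c , g ⟫ ≈ ⟪ d , g ⟫
  ⟪⟫-congˡ g c≈d = ⟪⟫-cong λ e → *-congʳ (c≈d e)

  ∑ₑ-of-single : ∀ (e : Edge n) x → ∑ₑ (single e x) ≈ x
  ∑ₑ-of-single e x =
    trans (sym (⟪⟫-1 (single e x))) (trans (⟪⟫-single e x (λ _ → 1#)) (*-identityʳ x))

  ∑ₑ-of-zero : {g : Edge n → Carrier} → (∀ e → g e ≈ 0#) → ∑ₑ g ≈ 0#
  ∑ₑ-of-zero g≈0 = trans (∑ₑ-single (zero , zero) λ e _ → g≈0 e) (g≈0 (zero , zero))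

  ⟪⟫-singleʳ : ∀ (c : Edge n → Carrier) e → ⟪ c , single e 1# ⟫ ≈ c e
  ⟪⟫-singleʳ c e =
    trans (⟪⟫-comm c _) (trans (⟪⟫-single e 1# c) (*-identityˡ (c e)))

  comb : (Edge n → Carrier) → Vertex n → Carrier
  comb c v = ⟪ c , (λ e → root e v) ⟫

  comb-zero : (v : Vertex n) → comb (λ _ → 0#) v ≈ 0#
  comb-zero v = trans (reflexive (⟪⟫≡∑ₑ _ _)) (∑ₑ-of-zero λ e → zeroˡ (root e v))

  ∑-basis : ∀ (φ : Vertex n → Carrier) i → ∑ (λ v → φ v * basis i v) ≈ φ i
  ∑-basis φ i = trans (∑-single i off) (trans (*-congˡ (reflexive on)) (*-identityʳ _))
    where
    on : basis i i ≡ 1#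
    on rewrite dec-true (i Fin.≟ i) ≡.refl = ≡.refl
    off : ∀ v → i ≢ v → φ v * basis i v ≈ 0#
    off v i≢v rewrite dec-false (i Fin.≟ v) i≢v = zeroʳ _

  ∑-root : ∀ (φ : Vertex n → Carrier) e → ∑ (λ v → φ v * root e v) ≈ ∂ φ e
  ∑-root φ (i , j) = begin
    ∑ (λ v → φ v * root (i , j) v)
      ≈⟨ ∑-cong (λ v → x[y-z]≈xy-xz (φ v) (basis i v) (basis j v)) ⟩
    ∑ (λ v → φ v * basis i v - φ v * basis j v)
      ≈⟨ ∑-+ (λ v → φ v * basis i v) (λ v → - (φ v * basis j v)) ⟩
    ∑ (λ v → φ v * basis i v) + ∑ (λ v → - (φ v * basis j v))
      ≈⟨ +-cong (∑-basis φ i) (trans (∑-neg _) (-‿cong (∑-basis φ j))) ⟩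
    φ i - φ j ∎

  opaque
    unfolding ⟪_,_⟫

    -- The boundary `comb` and the coboundary `∂` are transposes of each other. A linear functional
    -- applied to a point thus becomes a pairing of its coefficients with edge differences.
    ∑-comb : ∀ (φ : Vertex n → Carrier) c → ∑ (λ v → φ v * comb c v) ≈ ⟪ c , ∂ φ ⟫
    ∑-comb φ c = begin
      ∑ (λ v → φ v * comb c v)
        ≈⟨ ∑-cong (λ v → *-∑ₑ (φ v) (λ e → c e * root e v)) ⟩
      ∑ (λ v → ∑ₑ λ e → φ v * (c e * root e v))
        ≈⟨ ∑-∑ₑ-swap (λ v e → φ v * (c e * root e v)) ⟩
      ∑ₑ (λ e → ∑ λ v → φ v * (c e * root e v))
        ≈⟨ ∑ₑ-cong (λ e → ∑-cong λ v → x∙yz≈y∙xz (φ v) (c e) (root e v)) ⟩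
      ∑ₑ (λ e → ∑ λ v → c e * (φ v * root e v))
        ≈⟨ ∑ₑ-cong (λ e → trans (sym (*-∑ (c e) (λ v → φ v * root e v)))
                                (*-congˡ (∑-root φ e))) ⟩
      ⟪ c , ∂ φ ⟫ ∎

module ℤ-Sums = EdgeSums ℤ.+-*-commutativeRing

-- Cardinalities

module _ where
  open ≡ hiding ([_])

  private
    variable
      b : Level
      B : Set b
      k l m : ℕ
      P : Pred A p
      Q : Pred A q

  card-resp-⇔ : (∀ x → P x ⇔ Q x) → HasCardinality P m → HasCardinality Q m
  card-resp-⇔ P⇔Q (xs , u , ∈⇔P , len) = xs , u , (λ x → P⇔Q x ⇔-∘ ∈⇔P x) , len

  -- Two duplicate-free lists with the same elements are permutations of each other.
  card-unique : HasCardinality P k → HasCardinality P m → k ≡ m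
  card-unique (xs , u , xs⇔P , refl) (ys , v , ys⇔P , refl) =
    ↭-length (∼bag⇒↭ (unique∧set⇒bag u v λ {x} → ⇔-sym (ys⇔P x) ⇔-∘ xs⇔P x))

  card-singleton : (x : A) → HasCardinality ｛ x ｝ 1
  card-singleton x = [ x ] , [] ∷ [] ,
    (λ y → mk⇔ (λ { (here refl) → refl }) λ { refl → here refl }) , refl

  card-⊎ : HasCardinality P k → HasCardinality Q m → (∀ {x} → P x → ¬ Q x) →
           HasCardinality (P ∪ Q) (k ℕ.+ m)
  card-⊎ (xs , u , xs⇔P , refl) (ys , v , ys⇔Q , refl) disjoint =
    xs ++ ys ,
    Unique.++⁺ u v (λ (x∈xs , x∈ys) → disjoint (to (xs⇔P _) x∈xs) (to (ys⇔Q _) x∈ys)) ,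
    (λ x → mk⇔ (Sum.map (to (xs⇔P x)) (to (ys⇔Q x)) ∘ ∈-++⁻ xs)
               [ ∈-++⁺ˡ ∘ from (xs⇔P x) , ∈-++⁺ʳ xs ∘ from (ys⇔Q x) ]′) ,
    length-++ xs

  card-∩ : Decidable Q → HasCardinality P m → ∃ λ k → HasCardinality (P ∩ Q) k
  card-∩ Q? (xs , u , xs⇔P , _) =
    _ , filter Q? xs , Unique.filter⁺ Q? u ,
    (λ x → mk⇔ (Product.map₁ (to (xs⇔P x)) ∘ ∈-filter⁻ Q?)
               λ (px , qx) → ∈-filter⁺ Q? (from (xs⇔P x) px) qx) ,
    refl

  card-split : Decidable Q → HasCardinality P m →
               ∃₂ λ k l → HasCardinality (P ∩ Q) k × HasCardinality (P ∖ Q) l × k ℕ.+ l ≡ m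
  card-split {Q = Q} {P = P} Q? P-card =
    let k , ∩-card = card-∩ Q? P-card
        l , ∖-card = card-∩ (¬? ∘ Q?) P-card
        ⊎-card = card-⊎ ∩-card ∖-card (λ (_ , qx) (_ , ¬qx) → ¬qx qx)
    in k , l , ∩-card , ∖-card ,
       card-unique (card-resp-⇔ (λ x → mk⇔ [ proj₁ , proj₁ ]′ (split x)) ⊎-card) P-card
    where
    split : ∀ x → P x → (P ∩ Q) x ⊎ (P ∖ Q) x
    split x px with Q? x
    ... | yes qx = inj₁ (px , qx)
    ... | no ¬qx = inj₂ (px , ¬qx)

  card-map : (g : A → B) (h : B → A) → (∀ x → h (g x) ≡ x) → (∀ y → g (h y) ≡ y) →
             HasCardinality P m → HasCardinality (P ∘ h) m
  card-map {P = P} g h h∘g g∘h (xs , u , xs⇔P , len) =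
    map g xs ,
    Unique.map⁺ (λ {x} {y} gx≡gy → trans (sym (h∘g x)) (trans (cong h gx≡gy) (h∘g y))) u ,
    (λ y → mk⇔ (λ y∈ → let x , x∈xs , y≡gx = ∈-map⁻ g y∈ in
                        subst P (sym (trans (cong h y≡gx) (h∘g x))) (to (xs⇔P x) x∈xs))
               λ phy → subst (_∈ _) (g∘h y) (∈-map⁺ g (from (xs⇔P (h y)) phy))) ,
    trans (length-map g xs) len

  module _ (_≟_ : DecidableEquality A) where
    open DecMembership _≟_ using (_∈?_)

    -- Inclusion-exclusion without subtraction. An enumerated `P` is decidable because equality is,
    -- so `Q` splits into its parts inside and outside `P`.
    card-∪ : {P : Pred A p} {Q : Pred A q} →
             HasCardinality P k → HasCardinality Q l → HasCardinality (P ∩ Q) m →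
             ∃ λ r → HasCardinality (P ∪ Q) r × r ℕ.+ m ≡ k ℕ.+ l
    card-∪ {k = k} {l = l} {m = m} {P = P} {Q} P-card@(xs , _ , xs⇔P , _) Q-card P∩Q-card
      with card-split P? Q-card
      where
      P? : Decidable P
      P? x = Dec.map (xs⇔P x) (x ∈? xs)
    ... | i , j , Q∩P-card , Q∖P-card , i+j≡l =
      k ℕ.+ j ,
      card-resp-⇔ (λ x → mk⇔ [ inj₁ , inj₂ ∘ proj₁ ]′ (split x))
                  (card-⊎ P-card Q∖P-card λ px (_ , ¬px) → ¬px px) ,
      (begin
        k ℕ.+ j ℕ.+ m   ≡⟨ cong (k ℕ.+ j ℕ.+_) (card-unique P∩Q-card
                             (card-resp-⇔ (λ x → mk⇔ Product.swap Product.swap) Q∩P-card)) ⟩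
        k ℕ.+ j ℕ.+ i   ≡⟨ ℕ.+-assoc k j i ⟩
        k ℕ.+ (j ℕ.+ i) ≡⟨ cong (k ℕ.+_) (trans (ℕ.+-comm j i) i+j≡l) ⟩
        k ℕ.+ l         ∎)
      where
      open ≡-Reasoning
      split : ∀ x → P x ⊎ Q x → P x ⊎ (Q x × ¬ P x)
      split x (inj₁ px) = inj₁ px
      split x (inj₂ qx) with x ∈? xs
      ... | yes x∈xs = inj₁ (to (xs⇔P x) x∈xs)
      ... | no  x∉xs = inj₂ (qx , x∉xs ∘ from (xs⇔P x))

    card-delete : {P : Pred A p} {x : A} → HasCardinality P m → P x →
                  ∃ λ k → HasCardinality (P ∖ ｛ x ｝) k × m ≡ suc k
    card-delete {P = P} {x = x} P-card px =
      let i , k , ∩-card , ∖-card , i+k≡m = card-split (x ≟_) P-card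
          i≡1 = card-unique ∩-card (card-resp-⇔ (λ y → mk⇔ (λ { refl → px , refl }) proj₂)
                                                (card-singleton x))
      in k , ∖-card , trans (sym i+k≡m) (cong (ℕ._+ k) i≡1)

  card-insert : {P : Pred A p} {x : A} → HasCardinality P m → ¬ P x →
                HasCardinality (P ∪ ｛ x ｝) (suc m)
  card-insert {m = m} {x = x} P-card ¬px =
    subst (HasCardinality _) (ℕ.+-comm m 1)
          (card-⊎ P-card (card-singleton x) λ { px refl → ¬px px })

-- Acyclicity of edge sets and its behaviour under reductions

module Lattice where
  open ≡ hiding ([_])
  open import Data.Vec.Base using (lookup)
  open import Data.Integer.Base using (_+_; _-_; -_; _*_; _^_; _≤_)
  open ℤ-Sums

  -- Forests are handled through the vanishing of their first cohomology: every
  -- weight function on the edges is the coboundary of a potential.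
  Acyclic : Pred (Edge n) p → Set p
  Acyclic {n} P = ∀ (w : Edge n → ℤ) → ∃ λ φ → ∀ {e} → P e → ∂ φ e ≡ w e

  acyclic-antitone : {P : Pred (Edge n) p} {Q : Pred (Edge n) q} →
                     (∀ {e} → Q e → P e) → Acyclic P → Acyclic Q
  acyclic-antitone Q⊆P acyclic w = let φ , ∂φ = acyclic w in φ , ∂φ ∘ Q⊆P

  ∂-triangle : ∀ (φ : Vertex n → ℤ) i j k → ∂ φ (i , k) ≡ ∂ φ (i , j) + ∂ φ (j , k)
  ∂-triangle φ i j k = identity (φ i) (φ j) (φ k)
    where
    identity : ∀ x y z → x - z ≡ (x - y) + (y - z)
    identity = solve-∀

  module _ {G : Graph n} (r : Reduction G) where
    open Reduction r using (i; j; k; ij∈E; jk∈E)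

    ij≢jk : (i , j) ≢ (j , k)
    ij≢jk eq = Fin.<-irrefl (cong proj₁ eq) (E-< G ij∈E)

    ij≢ik : (i , j) ≢ (i , k)
    ij≢ik eq = Fin.<-irrefl (cong proj₂ eq) (E-< G jk∈E)

    jk≢ik : (j , k) ≢ (i , k)
    jk≢ik eq = Fin.<-irrefl (sym (cong proj₁ eq)) (E-< G ij∈E)

    -- For the weight that is 1 on (i,k) and 0 elsewhere, a potential would give 1 = 0 + 0 around
    -- the triangle.
    ik∉E : Acyclic (E G) → ¬ E G (i , k)
    ik∉E acyclic ik∈E with acyclic (single (i , k) 1ℤ)
    ... | φ , ∂φ with trans (sym (single-same (i , k) 1ℤ)) (trans (sym (∂φ ik∈E))
                       (trans (∂-triangle φ i j k) (cong₂ _+_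
                         (trans (∂φ ij∈E) (single-other 1ℤ (ij≢ik ∘ sym)))
                         (trans (∂φ jk∈E) (single-other 1ℤ (jk≢ik ∘ sym))))))
    ... | ()

    -- The weight at the removed edge (j,k) is free, so it is changed to w(i,k) - w(i,j); the
    -- potential for `G` then has the right difference along the new edge.
    acyclic-G₁ : Acyclic (E G) → Acyclic (E (G₁ r))
    acyclic-G₁ acyclic w = let φ , ∂φ = acyclic w′ in φ , λ
      { (inj₁ (e∈E , jk≢e)) → trans (∂φ e∈E) (w′-other jk≢e)
      ; (inj₂ refl) → trans (∂-triangle φ i j k)
          (trans (cong₂ _+_ (trans (∂φ ij∈E) (w′-other (ij≢jk ∘ sym)))
                            (trans (∂φ jk∈E) (cong (_+_ (w (j , k))) (single-same (j , k) _))))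
                 (identity (w (i , j)) (w (j , k)) (w (i , k))))
      }
      where
      w′ : Edge n → ℤ
      w′ e = w e + single (j , k) (w (i , k) - w (i , j) - w (j , k)) e
      w′-other : ∀ {e} → (j , k) ≢ e → w′ e ≡ w e
      w′-other {e} jk≢e = trans (cong (_+_ (w e)) (single-other _ jk≢e)) (ℤ.+-identityʳ (w e))
      identity : ∀ x y z → x + (y + (z - x - y)) ≡ z
      identity = solve-∀

    acyclic-G₂ : Acyclic (E G) → Acyclic (E (G₂ r))
    acyclic-G₂ acyclic w = let φ , ∂φ = acyclic w′ in φ , λ
      { (inj₁ (e∈E , ij≢e)) → trans (∂φ e∈E) (w′-other ij≢e)
      ; (inj₂ refl) → trans (∂-triangle φ i j k)
          (trans (cong₂ _+_ (trans (∂φ ij∈E) (cong (_+_ (w (i , j))) (single-same (i , j) _)))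
                            (trans (∂φ jk∈E) (w′-other ij≢jk)))
                 (identity (w (i , j)) (w (j , k)) (w (i , k))))
      }
      where
      w′ : Edge n → ℤ
      w′ e = w e + single (i , j) (w (i , k) - w (i , j) - w (j , k)) e
      w′-other : ∀ {e} → (i , j) ≢ e → w′ e ≡ w e
      w′-other {e} ij≢e = trans (cong (_+_ (w e)) (single-other _ ij≢e)) (ℤ.+-identityʳ (w e))
      identity : ∀ x y z → (x + (z - x - y)) + y ≡ z
      identity = solve-∀

    G₃⊆G₁ : ∀ {e} → E (G₃ r) e → E (G₁ r) e
    G₃⊆G₁ (inj₁ ((e∈E , ij≢e) , jk≢e)) = inj₁ (e∈E , jk≢e)
    G₃⊆G₁ (inj₂ ik≡e)                  = inj₂ ik≡e

    G₃⊆G₂ : ∀ {e} → E (G₃ r) e → E (G₂ r) e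
    G₃⊆G₂ (inj₁ ((e∈E , ij≢e) , jk≢e)) = inj₁ (e∈E , ij≢e)
    G₃⊆G₂ (inj₂ ik≡e)                  = inj₂ ik≡e

    acyclic-G₃ : Acyclic (E G) → Acyclic (E (G₃ r))
    acyclic-G₃ acyclic = acyclic-antitone G₃⊆G₁ (acyclic-G₁ acyclic)

  -- Potentials along a cycle

  constant-chain : ∀ {m} (x : Fin (suc m) → A) → (∀ i → x (inject₁ i) ≡ x (suc i)) →
                   x zero ≡ x (fromℕ m)
  constant-chain {m = zero}  x step = refl
  constant-chain {m = suc m} x step = trans (step zero) (constant-chain (x ∘ suc) (step ∘ suc))

  acyclic⇒isForest : (G : Graph n) → Acyclic (E G) → IsForest G
  acyclic⇒isForest {n} G acyclic (m , v , inj , adj , closing) = main closing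
    where
    first last : Vertex n
    first = lookup v zero
    last  = lookup v (fromℕ (suc (suc m)))

    back : ∀ i → lookup v (suc i) ≢ first
    back i eq with inj (suc i) zero eq
    ... | ()

    -- This is where a cycle needs three vertices: the step that leaves the first vertex ends at
    -- index 1, which differs from the last index.
    chord : ∀ i → lookup v (inject₁ i) ≡ first → lookup v (suc i) ≡ last → ⊥
    chord zero    eq eq′ with inj (suc zero) (fromℕ (suc (suc m))) eq′
    ... | ()
    chord (suc i) eq eq′ with inj (suc (inject₁ i)) zero eq
    ... | ()

    -- A potential that jumps by 1 along the closing edge e₀ and nowhere else.
    absurd : ∀ e₀ → E G e₀ →
             (∀ i → e₀ ≢ (lookup v (inject₁ i) , lookup v (suc i))) →
             (∀ i → e₀ ≢ (lookup v (suc i) , lookup v (inject₁ i))) →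
             (∀ (φ : Vertex n → ℤ) → φ first ≡ φ last → ∂ φ e₀ ≡ 0ℤ) → ⊥
    absurd e₀ e₀∈E off₁ off₂ loop with acyclic (single e₀ 1ℤ)
    ... | φ , ∂φ with trans (sym (single-same e₀ 1ℤ)) (trans (sym (∂φ e₀∈E))
                          (loop φ (constant-chain (φ ∘ lookup v) step)))
      where
      step : ∀ i → φ (lookup v (inject₁ i)) ≡ φ (lookup v (suc i))
      step i with adj i
      ... | inj₁ e∈E = ℤ.i-j≡0⇒i≡j _ _ (trans (∂φ e∈E) (single-other 1ℤ (off₁ i)))
      ... | inj₂ e∈E = sym (ℤ.i-j≡0⇒i≡j _ _ (trans (∂φ e∈E) (single-other 1ℤ (off₂ i))))
    ... | ()

    main : Adjacent G last first → ⊥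
    main (inj₁ e∈E) = absurd (last , first) e∈E
      (λ i eq → back i (sym (cong proj₂ eq)))
      (λ i eq → chord i (sym (cong proj₂ eq)) (sym (cong proj₁ eq)))
      λ φ φ≡ → ℤ.i≡j⇒i-j≡0 (sym φ≡)
    main (inj₂ e∈E) = absurd (first , last) e∈E
      (λ i eq → chord i (sym (cong proj₁ eq)) (sym (cong proj₂ eq)))
      (λ i eq → back i (sym (cong proj₁ eq)))
      λ φ φ≡ → ℤ.i≡j⇒i-j≡0 φ≡

  -- Simple paths, components and potentials on forests

  record SimplePath {A : Set a} (R : Rel A p) (x y : A) : Set (a ⊔ p) where
    constructor mkPath
    field
      {size}    : ℕ
      vertices  : Vec A (suc size)
      injective : ∀ i j → lookup vertices i ≡ lookup vertices j → i ≡ j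
      linked    : ∀ i → R (lookup vertices (inject₁ i)) (lookup vertices (suc i))
      start     : lookup vertices zero ≡ x
      end       : lookup vertices (fromℕ size) ≡ y

  module _ {A : Set a} (_≟_ : DecidableEquality A) {R : Rel A p} where

    suffix : ∀ {x y} (π : SimplePath R x y) i → SimplePath R (lookup (SimplePath.vertices π) i) y
    suffix (mkPath v injective linked start end) zero = mkPath v injective linked refl end
    suffix (mkPath {suc _} (_ ∷ v) injective linked start end) (suc i) =
      suffix (mkPath v (λ i j → Fin.suc-injective ∘ injective (suc i) (suc j))
                     (linked ∘ suc) refl end) i

    -- Loop erasure: if the new start already lies on the simple path of the tail, everything before
    -- that occurrence is dropped.
    simplify : ∀ {x y} → Star R x y → SimplePath R x y
    simplify {x} ε = mkPath (x ∷ []) (λ { zero zero _ → refl }) (λ ()) refl refl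
    simplify {x} (s ◅ ss) with simplify ss
    ... | π@(mkPath v injective linked start end) with Fin.any? (λ i → lookup v i ≟ x)
    ... | yes (i , refl) = suffix π i
    ... | no fresh = mkPath (x ∷ v)
      (λ { zero    zero    _  → refl
         ; zero    (suc j) eq → contradiction (j , sym eq) fresh
         ; (suc i) zero    eq → contradiction (i , eq) fresh
         ; (suc i) (suc j) eq → cong suc (injective i j eq) })
      (λ { zero → subst (R x) (sym start) s ; (suc i) → linked i })
      refl end

  Connected : List (Edge n) → Rel (Vertex n) _
  Connected es = EqClosure λ u v → (u , v) ∈ es

  -- Read from the end of the list, each edge joins two different components of the graph built so
  -- far. This is the order in which `labelling` constructs a potential.
  data Independent {n} : List (Edge n) → Set where
    []  : Independent []
    _∷_ : ∀ {a b es} → ¬ Connected es a b → Independent es → Independent ((a , b) ∷ es)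

  -- A simple path in `es` between the ends of `(a , b)` is refuted by its length: 0 by a < b, 1 by
  -- the absence of duplicates or by the orientation of edges, and anything longer by closing it to
  -- a cycle.
  forest⇒independent : (G : Graph n) → IsForest G →
                       ∀ {es} → Unique es → All (E G) es → Independent es
  forest⇒independent G forest [] [] = []
  forest⇒independent G forest {(a , b) ∷ es} unique@(_ ∷ unique′) (ab∈E ∷ es⊆E) =
    not-connected ∘ simplify Fin._≟_ ∷ forest⇒independent G forest unique′ es⊆E
    where
    adjacent : ∀ {u v} → SymClosure (λ u v → (u , v) ∈ es) u v → Adjacent G u v
    adjacent (fwd uv∈es) = inj₁ (All.lookup es⊆E uv∈es)
    adjacent (bwd vu∈es) = inj₂ (All.lookup es⊆E vu∈es)

    not-connected : ¬ SimplePath (SymClosure λ u v → (u , v) ∈ es) a b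
    not-connected (mkPath {zero} _ _ _ refl refl) = Fin.<-irrefl refl (E-< G ab∈E)
    not-connected (mkPath {suc zero} (_ ∷ _ ∷ []) _ linked refl refl) with linked zero
    ... | fwd ab∈es = Unique.Unique[x∷xs]⇒x∉xs unique ab∈es
    ... | bwd ba∈es = Fin.<-asym (E-< G ab∈E) (E-< G (All.lookup es⊆E ba∈es))
    -- `SimplePath` uses a vector and its lookups as `IsCycle` does, so the path together with
    -- `(a , b)` is a cycle as it stands.
    not-connected (mkPath {suc (suc m)} v injective linked refl refl) =
      forest (m , v , injective , adjacent ∘ linked , inj₂ ab∈E)

  -- A union-find structure: `label` picks a representative of each component, so a shift of the
  -- potential on a whole component is a function of the label.
  record Labelling (es : List (Edge n)) (w : Edge n → ℤ) : Set where
    field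
      label          : Vertex n → Vertex n
      label-edge     : ∀ {u v} → (u , v) ∈ es → label u ≡ label v
      connected      : ∀ {u v} → label u ≡ label v → Connected es u v
      potential      : Vertex n → ℤ
      potential-edge : ∀ {e} → e ∈ es → ∂ potential e ≡ w e

  -- A new edge `(a , b)` merges two different components. Adding a constant on the component of `b`
  -- keeps all old differences, and the constant in `shift` is the one that makes the difference
  -- along the new edge equal to its weight.
  labelling : ∀ {es} → Independent es → (w : Edge n → ℤ) → Labelling es w
  labelling [] w = record
    { label          = λ v → v
    ; label-edge     = λ ()
    ; connected      = λ { refl → ε }
    ; potential      = λ _ → 0ℤ
    ; potential-edge = λ ()
    }
  labelling {n} {(a , b) ∷ es} (¬connected ∷ independent) w = record
    { label          = relabel ∘ label
    ; label-edge     = λ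
        { (here refl)   → trans (relabel-other (¬connected ∘ connected)) (sym relabel-same)
        ; (there uv∈es) → cong relabel (label-edge uv∈es) }
    ; connected      = connected′
    ; potential      = λ v → potential v + shift (label v)
    ; potential-edge = λ
        { (here refl) →
            trans (cong₂ (λ s t → (potential a + s) - (potential b + t))
                         (shift-other (¬connected ∘ connected)) shift-same)
                  (cancel (potential a) (potential b) (w (a , b)))
        ; {u , v} (there uv∈es) →
            trans (cong (λ x → (potential u + shift x) - (potential v + shift (label v)))
                        (label-edge uv∈es))
                  (trans (translate (potential u) (potential v) _) (potential-edge uv∈es)) }
    }
    where
    open Labelling (labelling independent w)

    relabel : Vertex n → Vertex n
    relabel x = if does (x Fin.≟ label b) then label a else x

    relabel-same : relabel (label b) ≡ label a
    relabel-same rewrite dec-true (label b Fin.≟ label b) refl = refl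

    relabel-other : ∀ {x} → x ≢ label b → relabel x ≡ x
    relabel-other {x} x≢ rewrite dec-false (x Fin.≟ label b) x≢ = refl

    shift : Vertex n → ℤ
    shift x = if does (x Fin.≟ label b) then potential a - potential b - w (a , b) else 0ℤ

    shift-same : shift (label b) ≡ potential a - potential b - w (a , b)
    shift-same rewrite dec-true (label b Fin.≟ label b) refl = refl

    shift-other : ∀ {x} → x ≢ label b → shift x ≡ 0ℤ
    shift-other {x} x≢ rewrite dec-false (x Fin.≟ label b) x≢ = refl

    weaken : ∀ {u v} → Connected es u v → Connected ((a , b) ∷ es) u v
    weaken = EqClosure.map there

    ab : Connected ((a , b) ∷ es) a b
    ab = EqClosure.return (here refl)

    connected′ : ∀ {u v} → relabel (label u) ≡ relabel (label v) → Connected ((a , b) ∷ es) u v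
    connected′ {u} {v} eq with label u Fin.≟ label b | label v Fin.≟ label b
    ... | yes u≡b | yes v≡b = weaken (connected (trans u≡b (sym v≡b)))
    ... | yes u≡b | no  _   =
      weaken (connected u≡b) ◅◅ EqClosure.symmetric _ ab ◅◅ weaken (connected eq)
    ... | no  _   | yes v≡b = weaken (connected eq) ◅◅ ab ◅◅ weaken (connected (sym v≡b))
    ... | no  _   | no  _   = weaken (connected eq)

    cancel : ∀ x y z → (x + 0ℤ) - (y + (x - y - z)) ≡ z
    cancel = solve-∀

    translate : ∀ x y s → (x + s) - (y + s) ≡ x - y
    translate = solve-∀

  -- Edge lists and the number of edges under reductions

  ∈-edges⁺ : (G : Graph n) → ∀ {e} → E G e → e ∈ edges G
  ∈-edges⁺ G e∈E = ∈-filter⁺ (E? G) (∈-cartesianProduct⁺ (∈-allFin _) (∈-allFin _)) e∈E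

  ∈-edges⁻ : (G : Graph n) → ∀ {e} → e ∈ edges G → E G e
  ∈-edges⁻ G e∈ = proj₂ (∈-filter⁻ (E? G) {xs = cartesianProduct (allFin _) (allFin _)} e∈)

  edges-unique : (G : Graph n) → Unique (edges G)
  edges-unique G = Unique.filter⁺ (E? G)
    (Unique.cartesianProduct⁺ (Unique.allFin⁺ _) (Unique.allFin⁺ _))

  card-edges : (G : Graph n) → HasCardinality (E G) (numEdges G)
  card-edges G = edges G , edges-unique G , (λ e → mk⇔ (∈-edges⁻ G) (∈-edges⁺ G)) , refl

  forest⇒acyclic : (F : Graph n) → IsForest F → Acyclic (E F)
  forest⇒acyclic F forest w = potential , potential-edge ∘ ∈-edges⁺ F
    where
    open Labelling (labelling
      (forest⇒independent F forest (edges-unique F) (All.tabulate (∈-edges⁻ F))) w)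

  module _ {G : Graph n} (r : Reduction G) (acyclic : Acyclic (E G)) where
    open Reduction r using (i; j; k; ij∈E; jk∈E)

    -- By `ik∉E` the inserted edge is really new, so it makes up for exactly one removed edge;
    -- likewise for the other two graphs.
    numEdges-G₁ : numEdges (G₁ r) ≡ numEdges G
    numEdges-G₁ with card-delete _≟ₑ_ (card-edges G) jk∈E
    ... | m , card , G≡ = trans (card-unique (card-edges (G₁ r))
                                   (card-insert card (ik∉E r acyclic ∘ proj₁)))
                                (sym G≡)

    numEdges-G₂ : numEdges (G₂ r) ≡ numEdges G
    numEdges-G₂ with card-delete _≟ₑ_ (card-edges G) ij∈E
    ... | m , card , G≡ = trans (card-unique (card-edges (G₂ r))
                                   (card-insert card (ik∉E r acyclic ∘ proj₁)))
                                (sym G≡)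

    numEdges-G₃ : suc (numEdges (G₃ r)) ≡ numEdges G
    numEdges-G₃ with card-delete _≟ₑ_ (card-edges G) ij∈E
    ... | m , card , G≡ with card-delete _≟ₑ_ card (jk∈E , ij≢jk r)
    ... | m′ , card′ , m≡ = trans (cong suc (trans (card-unique (card-edges (G₃ r))
                                     (card-insert card′ (ik∉E r acyclic ∘ proj₁ ∘ proj₁))) (sym m≡)))
                                  (sym G≡)

  -- Integral points of a cone and their coefficients under a reduction

  pair : (Vertex n → ℤ) → Vec ℤ (suc n) → ℤ
  pair φ z = ∑ λ v → φ v * lookup z v

  -- An integral certificate of membership in the cone over `P`. For a forest, `cone⇒decomposition`
  -- produces one for every lattice point of the cone over the field.
  record Decomposition {n} (P : Pred (Edge n) p) (z : Vec ℤ (suc n)) : Set p where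
    field
      coeff   : Edge n → ℤ
      nonneg  : ∀ e → 0ℤ ≤ coeff e
      support : ∀ {e} → ¬ P e → coeff e ≡ 0ℤ
      expand  : ∀ v → lookup z v ≡ comb coeff v

  open Decomposition public

  module _ {P : Pred (Edge n) p} {z : Vec ℤ (suc n)} where

    pair-expand : (D : Decomposition P z) (φ : Vertex n → ℤ) → pair φ z ≡ ⟪ coeff D , ∂ φ ⟫
    pair-expand D φ = trans (∑-cong λ v → cong (φ v *_) (expand D v)) (∑-comb φ (coeff D))

    pair-potential : Decidable P → (D : Decomposition P z) {φ : Vertex n → ℤ} {w : Edge n → ℤ} →
                     (∀ {e} → P e → ∂ φ e ≡ w e) → pair φ z ≡ ⟪ coeff D , w ⟫
    pair-potential P? D {φ} {w} ∂φ = trans (pair-expand D φ) (⟪⟫-cong agree)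
      where
      agree : ∀ e → coeff D e * ∂ φ e ≡ coeff D e * w e
      agree e with P? e
      ... | yes e∈P = cong (coeff D e *_) (∂φ e∈P)
      ... | no  e∉P rewrite support D e∉P = refl

    coeff-potential : Decidable P → (D : Decomposition P z) {φ : Vertex n → ℤ} (e : Edge n) →
                      (∀ {e′} → P e′ → ∂ φ e′ ≡ single e 1ℤ e′) → pair φ z ≡ coeff D e
    coeff-potential P? D {φ} e ∂φ = trans (pair-potential P? D {φ} ∂φ) (⟪⟫-singleʳ (coeff D) e)

    -- Pairing with a potential of the indicator of `e` computes the coefficient at `e` from `z`
    -- alone.
    coeff-unique : Decidable P → Acyclic P → (D D′ : Decomposition P z) →
                   ∀ e → coeff D e ≡ coeff D′ e
    coeff-unique P? acyclic D D′ e =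
      let φ , ∂φ = acyclic (single e 1ℤ)
      in trans (sym (coeff-potential P? D {φ} e ∂φ)) (coeff-potential P? D′ {φ} e ∂φ)

  decomposition-mono : {P : Pred (Edge n) p} {Q : Pred (Edge n) q} {z : Vec ℤ (suc n)} →
                       (∀ {e} → P e → Q e) → Decomposition P z → Decomposition Q z
  decomposition-mono P⊆Q D = record
    { coeff   = coeff D
    ; nonneg  = nonneg D
    ; support = λ e∉Q → support D (e∉Q ∘ P⊆Q)
    ; expand  = expand D
    }

  module _ {G : Graph n} (r : Reduction G) {z : Vec ℤ (suc n)} where
    open Reduction r using (i; j; k; ij∈E; jk∈E)

    private
      ij jk ik : Edge n
      ij = i , j
      jk = j , k
      ik = i , k

    by-edge : (Q : Pred (Edge n) q) → Q ij → Q jk → Q ik →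
              (∀ {e} → ij ≢ e → jk ≢ e → ik ≢ e → Q e) → ∀ e → Q e
    by-edge Q q-ij q-jk q-ik q e with ij ≟ₑ e | jk ≟ₑ e | ik ≟ₑ e
    ... | yes refl | _        | _        = q-ij
    ... | no _     | yes refl | _        = q-jk
    ... | no _     | no _     | yes refl = q-ik
    ... | no ij≢e  | no jk≢e  | no ik≢e  = q ij≢e jk≢e ik≢e

    -- Moves `m` units from the path i, j, k to the chord (i,k); a negative `m` moves them back. The
    -- combination is unchanged because the root of the chord is the sum of the two roots of the
    -- path.
    reroute : ℤ → (Edge n → ℤ) → Edge n → ℤ
    reroute m c e = c e + (single ik m e + (single ij (- m) e + single jk (- m) e))

    module _ (m : ℤ) (c : Edge n → ℤ) where

      reroute-ij : reroute m c ij ≡ c ij - m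
      reroute-ij = trans (cong (_+_ (c ij)) (cong₂ _+_ (single-other m (ij≢ik r ∘ sym))
                     (cong₂ _+_ (single-same ij (- m)) (single-other (- m) (ij≢jk r ∘ sym)))))
                   (identity (c ij) m)
        where
        identity : ∀ x m → x + (0ℤ + (- m + 0ℤ)) ≡ x - m
        identity = solve-∀

      reroute-jk : reroute m c jk ≡ c jk - m
      reroute-jk = trans (cong (_+_ (c jk)) (cong₂ _+_ (single-other m (jk≢ik r ∘ sym))
                     (cong₂ _+_ (single-other (- m) (ij≢jk r)) (single-same jk (- m)))))
                   (identity (c jk) m)
        where
        identity : ∀ x m → x + (0ℤ + (0ℤ + - m)) ≡ x - m
        identity = solve-∀

      reroute-ik : reroute m c ik ≡ c ik + m
      reroute-ik = trans (cong (_+_ (c ik)) (cong₂ _+_ (single-same ik m)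
                     (cong₂ _+_ (single-other (- m) (ij≢ik r)) (single-other (- m) (jk≢ik r)))))
                   (identity (c ik) m)
        where
        identity : ∀ x m → x + (m + (0ℤ + 0ℤ)) ≡ x + m
        identity = solve-∀

      reroute-other : ∀ {e} → ij ≢ e → jk ≢ e → ik ≢ e → reroute m c e ≡ c e
      reroute-other {e} ij≢e jk≢e ik≢e =
        trans (cong (_+_ (c e)) (cong₂ _+_ (single-other m ik≢e)
                 (cong₂ _+_ (single-other (- m) ij≢e) (single-other (- m) jk≢e))))
              (ℤ.+-identityʳ (c e))

      comb-reroute : ∀ v → comb (reroute m c) v ≡ comb c v
      comb-reroute v = begin
        comb (reroute m c) v
          ≡⟨ ⟪⟫-+ c _ (λ e → root e v) ⟩
        comb c v + comb (λ e → single ik m e + (single ij (- m) e + single jk (- m) e)) v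
          ≡⟨ cong (_+_ (comb c v)) (⟪⟫-+ (single ik m) _ (λ e → root e v)) ⟩
        comb c v + (comb (single ik m) v + comb (λ e → single ij (- m) e + single jk (- m) e) v)
          ≡⟨ cong₂ (λ x y → comb c v + (x + y)) (⟪⟫-single ik m (λ e → root e v))
               (trans (⟪⟫-+ (single ij (- m)) _ (λ e → root e v))
                      (cong₂ _+_ (⟪⟫-single ij (- m) (λ e → root e v))
                                 (⟪⟫-single jk (- m) (λ e → root e v)))) ⟩
        comb c v + (m * root ik v + (- m * root ij v + - m * root jk v))
          ≡⟨ cong (λ x → comb c v + (m * x + (- m * root ij v + - m * root jk v)))
                  (∂-triangle (λ x → basis x v) i j k) ⟩
        comb c v + (m * (root ij v + root jk v) + (- m * root ij v + - m * root jk v))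
          ≡⟨ identity (comb c v) m (root ij v) (root jk v) ⟩
        comb c v ∎
        where
        open ≡-Reasoning
        identity : ∀ x m y z → x + (m * (y + z) + (- m * y + - m * z)) ≡ x
        identity = solve-∀

    rerouted : {P : Pred (Edge n) p} {Q : Pred (Edge n) q} (D : Decomposition P z) (m : ℤ) →
               0ℤ ≤ coeff D ij - m → 0ℤ ≤ coeff D jk - m → 0ℤ ≤ coeff D ik + m →
               (¬ Q ij → coeff D ij - m ≡ 0ℤ) → (¬ Q jk → coeff D jk - m ≡ 0ℤ) →
               (¬ Q ik → coeff D ik + m ≡ 0ℤ) →
               (∀ {e} → ij ≢ e → jk ≢ e → ik ≢ e → P e → Q e) → Decomposition Q z
    rerouted {Q = Q} D m 0≤ij 0≤jk 0≤ik ij∉Q jk∉Q ik∉Q P⊆Q = record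
      { coeff   = reroute m c
      ; nonneg  = by-edge (λ e → 0ℤ ≤ reroute m c e)
          (subst (0ℤ ≤_) (sym (reroute-ij m c)) 0≤ij)
          (subst (0ℤ ≤_) (sym (reroute-jk m c)) 0≤jk)
          (subst (0ℤ ≤_) (sym (reroute-ik m c)) 0≤ik)
          (λ ij≢e jk≢e ik≢e → subst (0ℤ ≤_) (sym (reroute-other m c ij≢e jk≢e ik≢e)) (nonneg D _))
      ; support = λ {e} → by-edge (λ e → ¬ Q e → reroute m c e ≡ 0ℤ)
          (trans (reroute-ij m c) ∘ ij∉Q)
          (trans (reroute-jk m c) ∘ jk∉Q)
          (trans (reroute-ik m c) ∘ ik∉Q)
          (λ ij≢e jk≢e ik≢e e∉Q → trans (reroute-other m c ij≢e jk≢e ik≢e)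
                                        (support D (e∉Q ∘ P⊆Q ij≢e jk≢e ik≢e)))
          e
      ; expand  = λ v → trans (expand D v) (sym (comb-reroute m c v))
      }
      where c = coeff D

    ij∈G₁ : E (G₁ r) ij
    ij∈G₁ = inj₁ (ij∈E , ij≢jk r ∘ sym)

    jk∈G₂ : E (G₂ r) jk
    jk∈G₂ = inj₁ (jk∈E , ij≢jk r)

    -- The smaller of the two path coefficients is moved to the chord. The edge that carried it is
    -- left with 0, and this is the edge that `G₁` or `G₂` lacks.
    decomposition-reduce : Decomposition (E G) z →
                           Decomposition (E (G₁ r)) z ⊎ Decomposition (E (G₂ r)) z
    decomposition-reduce D with ℤ.≤-total (coeff D jk) (coeff D ij)
    ... | inj₁ jk≤ij = inj₁ (rerouted D (coeff D jk)
            (ℤ.i≤j⇒0≤j-i jk≤ij) (ℤ.≤-reflexive (sym (ℤ.+-inverseʳ (coeff D jk))))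
            (ℤ.+-mono-≤ (nonneg D ik) (nonneg D jk))
            (contradiction ij∈G₁) (λ _ → ℤ.+-inverseʳ (coeff D jk)) (contradiction (inj₂ refl))
            (λ _ jk≢e _ e∈E → inj₁ (e∈E , jk≢e)))
    ... | inj₂ ij≤jk = inj₂ (rerouted D (coeff D ij)
            (ℤ.≤-reflexive (sym (ℤ.+-inverseʳ (coeff D ij)))) (ℤ.i≤j⇒0≤j-i ij≤jk)
            (ℤ.+-mono-≤ (nonneg D ik) (nonneg D ij))
            (λ _ → ℤ.+-inverseʳ (coeff D ij)) (contradiction jk∈G₂) (contradiction (inj₂ refl))
            (λ ij≢e _ _ e∈E → inj₁ (e∈E , ij≢e)))

    -- All that lies on the chord is sent back along i, j, k, whose two edges belong to `G`.
    expand-ik : {P : Pred (Edge n) p} → (∀ {e} → ik ≢ e → P e → E G e) →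
                Decomposition P z → Decomposition (E G) z
    expand-ik P⊆E D = rerouted D (- coeff D ik)
      (0≤x+ik ij) (0≤x+ik jk) (subst (0ℤ ≤_) (sym (ℤ.+-inverseʳ (coeff D ik))) ℤ.≤-refl)
      (contradiction ij∈E) (contradiction jk∈E) (λ _ → ℤ.+-inverseʳ (coeff D ik))
      (λ _ _ → P⊆E)
      where
      0≤x+ik : ∀ e → 0ℤ ≤ coeff D e - - coeff D ik
      0≤x+ik e = subst (λ x → 0ℤ ≤ coeff D e + x) (sym (ℤ.neg-involutive (coeff D ik)))
                       (ℤ.+-mono-≤ (nonneg D e) (nonneg D ik))

    expand-G₁ : Decomposition (E (G₁ r)) z → Decomposition (E G) z
    expand-G₁ = expand-ik λ
      { _    (inj₁ (e∈E , _)) → e∈E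
      ; ik≢e (inj₂ ik≡e)      → contradiction ik≡e ik≢e }

    expand-G₂ : Decomposition (E (G₂ r)) z → Decomposition (E G) z
    expand-G₂ = expand-ik λ
      { _    (inj₁ (e∈E , _)) → e∈E
      ; ik≢e (inj₂ ik≡e)      → contradiction ik≡e ik≢e }

    -- Comparing the two expansions in G gives c₁(ij) + c₂(jk) = 0.
    decomposition-meet : Acyclic (E G) → Decomposition (E (G₁ r)) z → Decomposition (E (G₂ r)) z →
                         Decomposition (E (G₃ r)) z
    decomposition-meet acyclic D₁ D₂ = record
      { coeff = coeff D₁ ; nonneg = nonneg D₁ ; expand = expand D₁
      ; support = λ {e} → by-edge (λ e → ¬ E (G₃ r) e → coeff D₁ e ≡ 0ℤ)
          (λ _ → ij₁≡0) (λ _ → jk₁≡0) (contradiction (inj₂ refl))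
          (λ ij≢e jk≢e ik≢e e∉G₃ → support D₁ λ
            { (inj₁ (e∈E , _)) → e∉G₃ (inj₁ ((e∈E , ij≢e) , jk≢e)) ; (inj₂ ik≡e) → ik≢e ik≡e })
          e
      }
      where
      c₁ = coeff D₁
      c₂ = coeff D₂

      agree : ∀ e → coeff (expand-G₁ D₁) e ≡ coeff (expand-G₂ D₂) e
      agree = coeff-unique (E? G) acyclic (expand-G₁ D₁) (expand-G₂ D₂)

      jk₁≡0 : c₁ jk ≡ 0ℤ
      jk₁≡0 = support D₁ λ { (inj₁ (_ , jk≢jk)) → jk≢jk refl ; (inj₂ ik≡jk) → jk≢ik r (sym ik≡jk) }

      ij₂≡0 : c₂ ij ≡ 0ℤ
      ij₂≡0 = support D₂ λ { (inj₁ (_ , ij≢ij)) → ij≢ij refl ; (inj₂ ik≡ij) → ij≢ik r (sym ik≡ij) }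

      ij-eq : c₁ ij - - c₁ ik ≡ 0ℤ - - c₂ ik
      ij-eq = trans (sym (reroute-ij (- c₁ ik) c₁)) (trans (agree ij)
                (trans (reroute-ij (- c₂ ik) c₂) (cong (_- - c₂ ik) ij₂≡0)))

      jk-eq : 0ℤ - - c₁ ik ≡ c₂ jk - - c₂ ik
      jk-eq = trans (cong (_- - c₁ ik) (sym jk₁≡0)) (trans (sym (reroute-jk (- c₁ ik) c₁))
                (trans (agree jk) (reroute-jk (- c₂ ik) c₂)))

      ij₁≡-jk₂ : c₁ ij ≡ - c₂ jk
      ij₁≡-jk₂ = begin
        c₁ ij                                      ≡⟨ id₁ (c₁ ij) (c₁ ik) ⟩
        (c₁ ij - - c₁ ik) - (0ℤ - - c₁ ik)         ≡⟨ cong₂ _-_ ij-eq jk-eq ⟩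
        (0ℤ - - c₂ ik) - (c₂ jk - - c₂ ik)         ≡⟨ id₂ (c₂ jk) (c₂ ik) ⟩
        - c₂ jk                                    ∎
        where
        open ≡-Reasoning
        id₁ : ∀ x y → x ≡ (x - - y) - (0ℤ - - y)
        id₁ = solve-∀
        id₂ : ∀ x y → (0ℤ - - y) - (x - - y) ≡ - x
        id₂ = solve-∀

      ij₁≡0 : c₁ ij ≡ 0ℤ
      ij₁≡0 = ℤ.≤-antisym (subst (_≤ 0ℤ) (sym ij₁≡-jk₂) (ℤ.neg-mono-≤ (nonneg D₂ jk))) (nonneg D₁ ij)

  -- Inequalities for the dilated polytope, and coefficient sums

  Within : ℕ → Vec ℤ (suc n) → Set
  Within {n} t z = ∀ (χ : Vertex n → Bool) → pair (λ v → if χ v then 1ℤ else 0ℤ) z ≤ + t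

  -- For a forest these are the lattice points of the dilated polytope, described without the field.
  LatticeSet : Graph n → ℕ → Pred (Vec ℤ (suc n)) _
  LatticeSet G t z = Decomposition (E G) z × Within t z

  total : {P : Pred (Edge n) p} {z : Vec ℤ (suc n)} → Decomposition P z → ℤ
  total D = ∑ₑ (coeff D)

  Bounded : Pred (Edge n) p → ℕ → Pred (Vec ℤ (suc n)) _
  Bounded P t z = Σ (Decomposition P z) λ D → total D ≤ + t

  ∑ₑ-mono-≤ : {g h : Edge n → ℤ} → (∀ e → g e ≤ h e) → ∑ₑ g ≤ ∑ₑ h
  ∑ₑ-mono-≤ = ∑ₑ-mono _≤_ ℤ.≤-refl ℤ.+-mono-≤

  ⟪⟫-mono-≤ : (c : Edge n → ℤ) {g h : Edge n → ℤ} →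
              (∀ e → c e * g e ≤ c e * h e) → ⟪ c , g ⟫ ≤ ⟪ c , h ⟫
  ⟪⟫-mono-≤ c {g} {h} le rewrite ⟪⟫≡∑ₑ c g | ⟪⟫≡∑ₑ c h = ∑ₑ-mono-≤ le

  coeff≤total : {P : Pred (Edge n) p} {z : Vec ℤ (suc n)} (D : Decomposition P z) →
                ∀ e → coeff D e ≤ total D
  coeff≤total D e = subst (_≤ total D) (∑ₑ-of-single e (coeff D e)) (∑ₑ-mono-≤ le)
    where
    le : ∀ e′ → single e (coeff D e) e′ ≤ coeff D e′
    le e′ with e ≟ₑ e′
    ... | yes refl = ℤ.≤-refl
    ... | no _     = nonneg D e′

  ∂-indicator≤1 : ∀ (χ : Vertex n → Bool) e → ∂ (λ v → if χ v then 1ℤ else 0ℤ) e ≤ 1ℤ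
  ∂-indicator≤1 χ (a , b) with χ a | χ b
  ... | true  | true  = +≤+ ℕ.z≤n
  ... | true  | false = ℤ.≤-refl
  ... | false | true  = -≤+
  ... | false | false = +≤+ ℕ.z≤n

  -- Along an edge the indicator of a vertex set drops by at most 1, so its pairing with the point
  -- is at most the sum of the coefficients.
  bounded⇒within : {P : Pred (Edge n) p} {t : ℕ} {z : Vec ℤ (suc n)} → Bounded P t z → Within t z
  bounded⇒within {n = n} {t = t} {z} (D , total≤t) χ = begin
    pair φ z                  ≡⟨ pair-expand D φ ⟩
    ⟪ coeff D , ∂ φ ⟫         ≤⟨ ⟪⟫-mono-≤ (coeff D) (λ e →
                                   ℤ.*-monoˡ-≤-nonNeg (coeff D e) {{nonNegative (nonneg D e)}}
                                                      (∂-indicator≤1 χ e)) ⟩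
    ⟪ coeff D , (λ _ → 1ℤ) ⟫  ≡⟨ ⟪⟫-1 (coeff D) ⟩
    total D                   ≤⟨ total≤t ⟩
    + t                       ∎
    where
    open ℤ.≤-Reasoning
    φ : Vertex n → ℤ
    φ v = if χ v then 1ℤ else 0ℤ

  -- In an irreducible graph no vertex is both a source and a target of edges, so
  -- the indicator of the sources measures the sum of the coefficients.
  within⇒bounded : {G : Graph n} → ¬ Reduction G → {t : ℕ} {z : Vec ℤ (suc n)} →
                   LatticeSet G t z → Bounded (E G) t z
  within⇒bounded {G = G} irreducible {t} (D , within) =
    D , subst (_≤ + t) (trans (pair-potential (E? G) D {λ v → if source v then 1ℤ else 0ℤ} ∂χ)
                              (⟪⟫-1 (coeff D)))
                       (within source)
    where
    source : Vertex _ → Bool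
    source v = does (Fin.any? λ w → E? G (v , w))
    ∂χ : ∀ {e} → E G e → ∂ (λ v → if source v then 1ℤ else 0ℤ) e ≡ 1ℤ
    ∂χ {u , v} uv∈E
      rewrite dec-true (Fin.any? λ w → E? G (u , w)) (v , uv∈E)
            | dec-false (Fin.any? λ w → E? G (v , w)) (λ (w , vw∈E) →
                irreducible record { ij∈E = uv∈E ; jk∈E = vw∈E })
            = refl

  -- Counting points with bounded coefficient sum

  translate : ℤ → Edge n → Vec ℤ (suc n) → Vec ℤ (suc n)
  translate x e z = tabulate λ v → lookup z v + x * root e v

  lookup-translate : ∀ x (e : Edge n) z v → lookup (translate x e z) v ≡ lookup z v + x * root e v
  lookup-translate x e z = lookup∘tabulate λ v → lookup z v + x * root e v

  lookup-ext : {y z : Vec A n} → (∀ v → lookup y v ≡ lookup z v) → y ≡ z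
  lookup-ext {y = y} {z} y≗z =
    trans (sym (tabulate∘lookup y)) (trans (tabulate-cong y≗z) (tabulate∘lookup z))

  translate-inverse : ∀ x y → x + y ≡ 0ℤ → (e : Edge n) (z : Vec ℤ (suc n)) →
                      translate x e (translate y e z) ≡ z
  translate-inverse x y x+y≡0 e z = lookup-ext λ v → begin
    lookup (translate x e (translate y e z)) v   ≡⟨ lookup-translate x e (translate y e z) v ⟩
    lookup (translate y e z) v + x * root e v    ≡⟨ cong (_+ x * root e v) (lookup-translate y e z v) ⟩
    lookup z v + y * root e v + x * root e v     ≡⟨ identity (lookup z v) x y (root e v) ⟩
    lookup z v + (x + y) * root e v              ≡⟨ cong (λ s → lookup z v + s * root e v) x+y≡0 ⟩
    lookup z v + 0ℤ                              ≡⟨ ℤ.+-identityʳ _ ⟩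
    lookup z v                                   ∎
    where
    open ≡-Reasoning
    identity : ∀ s x y r → s + y * r + x * r ≡ s + (x + y) * r
    identity = solve-∀

  module _ {es : List (Edge n)} {z : Vec ℤ (suc n)} {e : Edge n} (e∈es : e ∈ es) where

    translated : (D : Decomposition (_∈ es) z) (x : ℤ) → 0ℤ ≤ coeff D e + x →
                 Decomposition (_∈ es) (translate x e z)
    translated D x 0≤ = record
      { coeff   = λ e′ → coeff D e′ + single e x e′
      ; nonneg  = nonneg′
      ; support = λ {e′} e′∉es → cong₂ _+_ (support D e′∉es)
                    (single-other {e = e} {e′} x λ { refl → e′∉es e∈es })
      ; expand  = λ v → trans (lookup-translate x e z v) (trans (cong₂ _+_ (expand D v)
                    (sym (⟪⟫-single e x (λ e → root e v))))
                    (sym (⟪⟫-+ (coeff D) (single e x) (λ e → root e v))))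
      }
      where
      nonneg′ : ∀ e′ → 0ℤ ≤ coeff D e′ + single e x e′
      nonneg′ e′ with e ≟ₑ e′
      ... | yes refl = 0≤
      ... | no _     = subst (0ℤ ≤_) (sym (ℤ.+-identityʳ _)) (nonneg D e′)

    total-translated : ∀ D x 0≤ → total (translated D x 0≤) ≡ total D + x
    total-translated D x 0≤ =
      trans (∑ₑ-+ (coeff D) (single e x)) (cong (_+_ (total D)) (∑ₑ-of-single e x))

  _∈?ₑ_ : (e : Edge n) (es : List (Edge n)) → _
  _∈?ₑ_ = DecMembership._∈?_ _≟ₑ_

  module _ {es : List (Edge n)} {e : Edge n} where

    drop-zero : {z : Vec ℤ (suc n)} (D : Decomposition (_∈ e ∷ es) z) → coeff D e ≡ 0ℤ →
                Decomposition (_∈ es) z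
    drop-zero D ≡0 = record
      { coeff = coeff D ; nonneg = nonneg D ; expand = expand D
      ; support = λ {e′} e′∉es → support′ e′∉es }
      where
      support′ : ∀ {e′} → e′ ∉ es → coeff D e′ ≡ 0ℤ
      support′ {e′} e′∉es with e ≟ₑ e′
      ... | yes refl = ≡0
      ... | no e≢e′ = support D λ { (here e′≡e) → e≢e′ (sym e′≡e) ; (there e′∈es) → e′∉es e′∈es }

    bounded-there : ∀ {t z} → Bounded (_∈ es) t z → Bounded (_∈ e ∷ es) t z
    bounded-there (D , total≤t) = decomposition-mono there D , total≤t

    bounded-translate : ∀ {t z} → Bounded (_∈ e ∷ es) t (translate -1ℤ e z) →
                        Bounded (_∈ e ∷ es) (suc t) z
    bounded-translate {t} {z} (D , total≤t) =
      subst (Bounded _ (suc t)) (translate-inverse 1ℤ -1ℤ refl e z)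
        (translated (here refl) D 1ℤ 0≤ ,
         subst₂ _≤_ (sym (total-translated (here refl) D 1ℤ 0≤)) (ℤ.+-comm (+ t) 1ℤ)
                    (ℤ.+-monoˡ-≤ 1ℤ total≤t))
      where 0≤ = ℤ.+-mono-≤ (nonneg D e) (+≤+ ℕ.z≤n)

    bounded-suc : ∀ {t z} → Bounded (_∈ e ∷ es) (suc t) z →
                  Bounded (_∈ es) (suc t) z ⊎ Bounded (_∈ e ∷ es) t (translate -1ℤ e z)
    bounded-suc {t} {z} (D , total≤t) with coeff D e ℤ.≟ 0ℤ
    ... | yes ≡0 = inj₁ (drop-zero D ≡0 , total≤t)
    ... | no  ≢0 = inj₂ (translated (here refl) D -1ℤ 0≤ ,
                         subst (_≤ + t) (sym (total-translated (here refl) D -1ℤ 0≤))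
                                        (ℤ.+-monoˡ-≤ -1ℤ total≤t))
      where 0≤ = ℤ.i≤j⇒0≤j-i {1ℤ} (ℤ.i<j⇒suc[i]≤j (ℤ.≤∧≢⇒< (nonneg D e) (≢0 ∘ sym)))

    bounded-zero : ∀ {z} → Bounded (_∈ e ∷ es) 0 z → Bounded (_∈ es) 0 z
    bounded-zero (D , total≤0) =
      drop-zero D (ℤ.≤-antisym (ℤ.≤-trans (coeff≤total D e) total≤0) (nonneg D e)) , total≤0

    -- By uniqueness of coefficients, a common point would have coefficient 0 at `e` from the first
    -- decomposition and at least 1 from the second.
    bounded-disjoint : ∀ {t z} → e ∉ es → Acyclic (_∈ e ∷ es) → Bounded (_∈ es) (suc t) z →
                       ¬ Bounded (_∈ e ∷ es) t (translate -1ℤ e z)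
    bounded-disjoint {t} {z} e∉es acyclic (D , _) (D′ , _) = contradiction 1≤0 λ { (+≤+ ()) }
      where
      0≤ = ℤ.+-mono-≤ (nonneg D′ e) (+≤+ ℕ.z≤n)
      D″ = translated (here refl) D′ 1ℤ 0≤
      -- `D″` decomposes a double translate that equals `z` only propositionally, hence the detour
      -- over an equal `z′`.
      same : ∀ {z′} → z ≡ z′ → (D′ : Decomposition (_∈ e ∷ es) z′) → coeff D e ≡ coeff D′ e
      same refl = λ D′ → coeff-unique (_∈?ₑ (e ∷ es)) acyclic (decomposition-mono there D) D′ e
      coeff≡ : coeff D′ e + 1ℤ ≡ 0ℤ
      coeff≡ = trans (cong (_+_ (coeff D′ e)) (sym (single-same e 1ℤ)))
                 (trans (sym (same (sym (translate-inverse 1ℤ -1ℤ refl e z)) D″)) (support D e∉es))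
      1≤0 : 1ℤ ≤ 0ℤ
      1≤0 = subst (1ℤ ≤_) coeff≡ (ℤ.+-monoˡ-≤ 1ℤ (nonneg D′ e))

  card-bounded : {es : List (Edge n)} → Unique es → Acyclic (_∈ es) → ∀ t →
                 HasCardinality (Bounded (_∈ es) t) ((t ℕ.+ length es) C length es)
  card-bounded {n} {[]} _ _ t =
    card-resp-⇔ (λ z → mk⇔ (λ { refl → zero-bounded }) (only-zero z))
                (card-singleton (replicate (suc n) 0ℤ))
    where
    zero-bounded : Bounded (_∈ []) t (replicate (suc n) 0ℤ)
    zero-bounded = record
      { coeff = λ _ → 0ℤ ; nonneg = λ _ → ℤ.≤-refl ; support = λ _ → refl
      ; expand = λ v → trans (lookup-replicate v 0ℤ) (sym (comb-zero v)) } ,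
      subst (_≤ + t) (sym (∑ₑ-of-zero λ _ → refl)) (+≤+ ℕ.z≤n)
    only-zero : ∀ z → Bounded (_∈ []) t z → replicate (suc n) 0ℤ ≡ z
    only-zero z (D , _) = lookup-ext λ v → trans (lookup-replicate v 0ℤ)
      (sym (trans (expand D v) (trans (⟪⟫-congˡ _ λ e → support D λ ()) (comb-zero v))))
  card-bounded {n} {e ∷ es} unique@(_ ∷ unique′) acyclic zero =
    subst (HasCardinality _) (trans (nCn≡1 (length es)) (sym (nCn≡1 (suc (length es)))))
      (card-resp-⇔ (λ z → mk⇔ bounded-there bounded-zero)
         (card-bounded unique′ (acyclic-antitone there acyclic) zero))
  card-bounded {n} {e ∷ es} unique@(_ ∷ unique′) acyclic (suc t) =
    subst (HasCardinality _) pascal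
      (card-resp-⇔ (λ z → mk⇔ [ bounded-there , bounded-translate ]′ bounded-suc)
        (card-⊎ (card-bounded unique′ (acyclic-antitone there acyclic) (suc t))
                (card-map (translate 1ℤ e) (translate -1ℤ e)
                   (translate-inverse -1ℤ 1ℤ refl e) (translate-inverse 1ℤ -1ℤ refl e)
                   (card-bounded unique acyclic t))
                (bounded-disjoint (Unique.Unique[x∷xs]⇒x∉xs unique) acyclic)))
    where
    l = length es
    pascal : (suc t ℕ.+ l) C l ℕ.+ (t ℕ.+ suc l) C suc l ≡ (suc t ℕ.+ suc l) C suc l
    pascal = trans (cong (λ x → x C l ℕ.+ (t ℕ.+ suc l) C suc l) (sym (ℕ.+-suc t l)))
                   (nCk+nC[k+1]≡[n+1]C[k+1] (t ℕ.+ suc l) l)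

  -- Lattice points at leaves and nodes of a reduction tree

  card-leaf : {G : Graph n} → ¬ Reduction G → Acyclic (E G) → ∀ t →
              HasCardinality (LatticeSet G t) ((t ℕ.+ numEdges G) C numEdges G)
  card-leaf {G = G} irreducible acyclic t =
    card-resp-⇔ (λ z → mk⇔
        (λ (D , total≤t) → decomposition-mono (∈-edges⁻ G) D , bounded⇒within (D , total≤t))
        (λ z∈ → let D , total≤t = within⇒bounded irreducible z∈
                 in decomposition-mono (∈-edges⁺ G) D , total≤t))
      (card-bounded (edges-unique G) (acyclic-antitone (∈-edges⁻ G) acyclic) t)

  -- `Within` is the same condition for all four graphs, so only the decompositions have to be
  -- compared.
  card-node : {G : Graph n} (r : Reduction G) → Acyclic (E G) → ∀ {t k l m} →
              HasCardinality (LatticeSet (G₁ r) t) k → HasCardinality (LatticeSet (G₂ r) t) l →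
              HasCardinality (LatticeSet (G₃ r) t) m →
              ∃ λ x → HasCardinality (LatticeSet G t) x × x ℕ.+ m ≡ k ℕ.+ l
  card-node r acyclic card₁ card₂ card₃ =
    let x , card , x+m≡k+l = card-∪ (≡-dec ℤ._≟_) card₁ card₂ (card-resp-⇔ (λ z → mk⇔
          (λ (D , within) → (decomposition-mono (G₃⊆G₁ r) D , within) ,
                            (decomposition-mono (G₃⊆G₂ r) D , within))
          (λ ((D₁ , within) , (D₂ , _)) → decomposition-meet r acyclic D₁ D₂ , within)) card₃)
    in x , card-resp-⇔ (λ z → mk⇔
          [ (λ (D , within) → expand-G₁ r D , within) , (λ (D , within) → expand-G₂ r D , within) ]′
          (λ (D , within) → Sum.map (_, within) (_, within) (decomposition-reduce r D))) card , x+m≡k+l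

  -- Here the tree shows that the inequalities of `Within` suffice. The point is followed to a leaf
  -- whose cone contains it, where the inequality for the set of sources bounds the sum of the
  -- coefficients.
  short : {G : Graph n} → STree G → ∀ {t z} → LatticeSet G t z → Bounded (E (complete n)) t z
  short {G = G} (leaf irreducible) z∈ =
    let D , total≤t = within⇒bounded irreducible z∈ in decomposition-mono (E-< G) D , total≤t
  short (node r T₁ T₂ _) (D , within) =
    [ (λ D₁ → short T₁ (D₁ , within)) , (λ D₂ → short T₂ (D₂ , within)) ]′ (decomposition-reduce r D)

  -- Signed counts of leaves

  signedBinomial : ℕ → ℕ → ℤ
  signedBinomial t i = -1ℤ ^ i * + ((t ℕ.+ i) C i)

  module SignedCount {a} {A : Set a} (size : A → ℕ) where

    signedCount : ℕ → List A → ℤ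
    signedCount t = foldr (λ x s → signedBinomial t (size x) + s) 0ℤ

    signedCount-++ : ∀ t xs ys → signedCount t (xs ++ ys) ≡ signedCount t xs + signedCount t ys
    signedCount-++ t []       ys = sym (ℤ.+-identityˡ _)
    signedCount-++ t (x ∷ xs) ys =
      trans (cong (_+_ (signedBinomial t (size x))) (signedCount-++ t xs ys))
            (sym (ℤ.+-assoc (signedBinomial t (size x)) (signedCount t xs) (signedCount t ys)))

    module _ {p} {P : Pred A p} (P? : Decidable P) where

      -- Has the same body as `f`, so that `f T k` is an instance of it by unfolding.
      count : List A → ℕ → ℕ
      count xs k = length (filter (λ x → P? x ×-dec (size x ℕ.≟ k)) xs)

      count-∷ : ∀ {x} → P x → ∀ xs k →
                + count (x ∷ xs) k ≡ (if does (size x ℕ.≟ k) then 1ℤ else 0ℤ) + + count xs k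
      count-∷ {x} px xs k with P? x
      ... | no ¬px = contradiction px ¬px
      ... | yes _ with does (size x ℕ.≟ k)
      ... | true  = refl
      ... | false = sym (ℤ.+-identityˡ _)

      -- Sorts the sum over the list by size. Each element contributes to exactly one index, which
      -- exists because its size is at most `l`.
      signedCount-count : ∀ t {l} xs → All (λ x → P x × size x ℕ.≤ l) xs →
        signedCount t xs ≡
        ∑ λ (i : Fin (suc l)) → -1ℤ ^ toℕ i * + count xs (toℕ i) * + ((t ℕ.+ toℕ i) C toℕ i)
      signedCount-count t [] [] =
        sym (∑-zero λ i → cong (_* + ((t ℕ.+ toℕ i) C toℕ i)) (ℤ.*-zeroʳ (-1ℤ ^ toℕ i)))
      signedCount-count t {l} (x ∷ xs) ((px , ≤l) ∷ rest) = sym (begin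
        ∑ (λ i → σ i * + count (x ∷ xs) (toℕ i) * b i)
          ≡⟨ ∑-cong (λ i → trans (cong (λ c → σ i * c * b i) (count-∷ px xs (toℕ i)))
                                 (distribute (σ i) (δ i) (+ count xs (toℕ i)) (b i))) ⟩
        ∑ (λ i → σ i * δ i * b i + σ i * + count xs (toℕ i) * b i)
          ≡⟨ ∑-+ (λ i → σ i * δ i * b i) (λ i → σ i * + count xs (toℕ i) * b i) ⟩
        ∑ (λ i → σ i * δ i * b i) + ∑ (λ i → σ i * + count xs (toℕ i) * b i)
          ≡⟨ cong₂ _+_ (trans (∑-single i₀ off) on) (sym (signedCount-count t xs rest)) ⟩
        signedCount t (x ∷ xs) ∎)
        where
        open ≡-Reasoning
        σ δ b : Fin (suc l) → ℤ
        σ i = -1ℤ ^ toℕ i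
        δ i = if does (size x ℕ.≟ toℕ i) then 1ℤ else 0ℤ
        b i = + ((t ℕ.+ toℕ i) C toℕ i)

        i₀ : Fin (suc l)
        i₀ = fromℕ< (ℕ.s≤s ≤l)

        toℕ-i₀ : toℕ i₀ ≡ size x
        toℕ-i₀ = Fin.toℕ-fromℕ< (ℕ.s≤s ≤l)

        off : ∀ i → i₀ ≢ i → σ i * δ i * b i ≡ 0ℤ
        off i i₀≢i = cong (_* b i) (trans
          (cong (λ d → σ i * (if d then 1ℤ else 0ℤ))
                (dec-false (size x ℕ.≟ toℕ i) λ x≡i → i₀≢i (Fin.toℕ-injective (trans toℕ-i₀ x≡i))))
          (ℤ.*-zeroʳ (σ i)))

        on : σ i₀ * δ i₀ * b i₀ ≡ signedBinomial t (size x)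
        on = begin
          σ i₀ * δ i₀ * b i₀            ≡⟨ cong (λ d → σ i₀ * (if d then 1ℤ else 0ℤ) * b i₀)
                                                (dec-true (size x ℕ.≟ toℕ i₀) (sym toℕ-i₀)) ⟩
          σ i₀ * 1ℤ * b i₀              ≡⟨ cong (_* b i₀) (ℤ.*-identityʳ (σ i₀)) ⟩
          signedBinomial t (toℕ i₀)     ≡⟨ cong (signedBinomial t) toℕ-i₀ ⟩
          signedBinomial t (size x)     ∎

        distribute : ∀ s d c b → s * (d + c) * b ≡ s * d * b + s * c * b
        distribute = solve-∀

  open module ForestCount {n} = SignedCount (numEdges {n})

  sign-square : ∀ l → -1ℤ ^ l * -1ℤ ^ l ≡ 1ℤ
  sign-square zero    = refl
  sign-square (suc l) = trans (identity (-1ℤ ^ l)) (sign-square l)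
    where
    identity : ∀ x → (-1ℤ * x) * (-1ℤ * x) ≡ x * x
    identity = solve-∀

  -- `G₁` and `G₂` have as many edges as `G`, and `G₃` has one fewer. The minus sign of the
  -- intersection is therefore absorbed into the power of -1 in front, and at a leaf the two signs
  -- cancel.
  card-tree : {G : Graph n} (T : STree G) → Acyclic (E G) → ∀ t →
              ∃ λ m → HasCardinality (LatticeSet G t) m ×
                      + m ≡ -1ℤ ^ numEdges G * signedCount t (leaves T)
  card-tree {G = G} (leaf irreducible) acyclic t =
    _ , card-leaf irreducible acyclic t , sym (begin
      s * (s * b + 0ℤ) ≡⟨ identity s b ⟩
      s * s * b        ≡⟨ cong (_* b) (sign-square (numEdges G)) ⟩
      1ℤ * b           ≡⟨ ℤ.*-identityˡ b ⟩
      b                ∎)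
    where
    open ≡-Reasoning
    s = -1ℤ ^ numEdges G
    b = + ((t ℕ.+ numEdges G) C numEdges G)
    identity : ∀ s b → s * (s * b + 0ℤ) ≡ s * s * b
    identity = solve-∀
  card-tree {G = G} (node r T₁ T₂ T₃) acyclic t
    with card-tree T₁ (acyclic-G₁ r acyclic) t
       | card-tree T₂ (acyclic-G₂ r acyclic) t
       | card-tree T₃ (acyclic-G₃ r acyclic) t
  ... | k , card₁ , k≡ | l , card₂ , l≡ | m , card₃ , m≡
    with card-node r acyclic card₁ card₂ card₃
  ... | x , card , x+m≡k+l = x , card , (begin
      + x                                                       ≡⟨ isolate (+ x) (+ m) ⟩
      + (x ℕ.+ m) - + m                                         ≡⟨ cong (λ y → + y - + m) x+m≡k+l ⟩
      + k + + l - + m                                           ≡⟨ cong₂ _-_ (cong₂ _+_ k≡ l≡) m≡ ⟩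
      -1ℤ ^ numEdges (G₁ r) * S₁ + -1ℤ ^ numEdges (G₂ r) * S₂ - -1ℤ ^ numEdges (G₃ r) * S₃
        -- With the exponent written as `suc (numEdges (G₃ r))` the power unfolds to `-1ℤ * s`, a
        -- common factor with the third term.
        ≡⟨ cong₂ (λ a b → -1ℤ ^ a * S₁ + -1ℤ ^ b * S₂ - -1ℤ ^ numEdges (G₃ r) * S₃)
                 (trans (numEdges-G₁ r acyclic) (sym (numEdges-G₃ r acyclic)))
                 (trans (numEdges-G₂ r acyclic) (sym (numEdges-G₃ r acyclic))) ⟩
      -1ℤ * s * S₁ + -1ℤ * s * S₂ - s * S₃                      ≡⟨ collect s S₁ S₂ S₃ ⟩
      -1ℤ * s * (S₁ + (S₂ + S₃))
        ≡⟨ cong₂ (λ a b → -1ℤ ^ a * b) (numEdges-G₃ r acyclic) (sym sum≡) ⟩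
      -1ℤ ^ numEdges G * signedCount t (leaves (node r T₁ T₂ T₃)) ∎)
    where
    open ≡-Reasoning
    s = -1ℤ ^ numEdges (G₃ r)
    S₁ = signedCount t (leaves T₁)
    S₂ = signedCount t (leaves T₂)
    S₃ = signedCount t (leaves T₃)
    sum≡ : signedCount t (leaves (node r T₁ T₂ T₃)) ≡ S₁ + (S₂ + S₃)
    sum≡ = trans (signedCount-++ t (leaves T₁) _)
                 (cong (_+_ S₁) (signedCount-++ t (leaves T₂) (leaves T₃)))
    isolate : ∀ x m → x ≡ (x + m) - m
    isolate = solve-∀
    collect : ∀ s a b c → -1ℤ * s * a + -1ℤ * s * b - s * c ≡ -1ℤ * s * (a + (b + c))
    collect = solve-∀

  -- Ensures that the sum over edge numbers reaches every leaf and that the forest test in `f`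
  -- discards none.
  leaves-bounded : {G : Graph n} (T : STree G) → Acyclic (E G) →
                   All (λ H → IsForest H × numEdges H ℕ.≤ numEdges G) (leaves T)
  leaves-bounded {G = G} (leaf _) acyclic = (acyclic⇒isForest G acyclic , ℕ.≤-refl) ∷ []
  leaves-bounded {G = G} (node r T₁ T₂ T₃) acyclic =
    All.++⁺ (weaken (ℕ.≤-reflexive (numEdges-G₁ r acyclic))
                    (leaves-bounded T₁ (acyclic-G₁ r acyclic)))
    (All.++⁺ (weaken (ℕ.≤-reflexive (numEdges-G₂ r acyclic))
                     (leaves-bounded T₂ (acyclic-G₂ r acyclic)))
         (weaken (ℕ.≤-trans (ℕ.n≤1+n _) (ℕ.≤-reflexive (numEdges-G₃ r acyclic)))
                 (leaves-bounded T₃ (acyclic-G₃ r acyclic))))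
    where
    weaken : ∀ {k Hs} → k ℕ.≤ numEdges G → All (λ H → IsForest H × numEdges H ℕ.≤ k) Hs →
             All (λ H → IsForest H × numEdges H ℕ.≤ numEdges G) Hs
    weaken k≤ = All.map λ (forest , ≤k) → forest , ℕ.≤-trans ≤k k≤

open Lattice

-- Ordered fields

module FieldProperties {a ℓ₁ ℓ₂ ℓ₃} (K : OrderedField a ℓ₁ ℓ₂ ℓ₃) where
  open OrderedField K hiding (zero)
  open CommutativeRing commutativeRing public using (semiring; ring)
  open IsStrictPartialOrder <-isStrictPartialOrder public
    using (<-respʳ-≈; <-respˡ-≈) renaming (irrefl to <-irrefl; trans to <-trans)
  open Polytopes K using (fromℤ)
  open import Algebra.Properties.Ring ring
    using (-0#≈0#; -‿+-comm; -‿involutive; -‿distribˡ-*; -‿distribʳ-*; x[y-z]≈xy-xz)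
  open import Algebra.Properties.Semiring.Mult semiring using (×-homo-+) renaming (_×_ to _·_)
  open import Relation.Binary.Reasoning.Setoid setoid

  0<⇒# : ∀ {x} → 0# < x → x # 0#
  0<⇒# = #-sym ∘ <⇒#

  -- The substitute for trichotomy: apartness is cotransitive, and apart elements are comparable.
  <-cotrans : ∀ {x y} → x < y → ∀ z → x < z ⊎ z < y
  <-cotrans {x} {y} x<y z with #-cotrans (<⇒# x<y) z
  ... | inj₁ x#z with #⇒<⊎> x#z
  ...   | inj₁ x<z = inj₁ x<z
  ...   | inj₂ z<x = inj₂ (<-trans z<x x<y)
  <-cotrans {x} {y} x<y z | inj₂ z#y with #⇒<⊎> z#y
  ...   | inj₁ z<y = inj₂ z<y
  ...   | inj₂ y<z = inj₁ (<-trans x<y y<z)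

  <⇒≤ : ∀ {x y} → x < y → x ≤ y
  <⇒≤ x<y y<x = <-irrefl refl (<-trans x<y y<x)

  ≤-reflexive : ∀ {x y} → x ≈ y → x ≤ y
  ≤-reflexive x≈y y<x = <-irrefl (sym x≈y) y<x

  ≤-trans : ∀ {x y z} → x ≤ y → y ≤ z → x ≤ z
  ≤-trans {y = y} x≤y y≤z z<x = [ y≤z , x≤y ]′ (<-cotrans z<x y)

  ≤-respʳ : ∀ {x y z} → y ≈ z → x ≤ y → x ≤ z
  ≤-respʳ y≈z x≤y = ≤-trans x≤y (≤-reflexive y≈z)

  ≤-respˡ : ∀ {x y z} → x ≈ y → x ≤ z → y ≤ z
  ≤-respˡ x≈y = ≤-trans (≤-reflexive (sym x≈y))

  +-cancelʳ-< : ∀ z {x y} → x + z < y + z → x < y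
  +-cancelʳ-< z {x} {y} x+z<y+z =
    <-respˡ-≈ (cancel x) (<-respʳ-≈ (cancel y) (+-monoˡ-< (- z) x+z<y+z))
    where
    cancel : ∀ w → w + z + - z ≈ w
    cancel w = trans (+-assoc w z (- z)) (trans (+-congˡ (-‿inverseʳ z)) (+-identityʳ w))

  +-mono-≤ : ∀ {w x y z} → w ≤ x → y ≤ z → w + y ≤ x + z
  +-mono-≤ {w} {x} {y} {z} w≤x y≤z x+z<w+y with <-cotrans x+z<w+y (x + y)
  ... | inj₁ x+z<x+y = y≤z (+-cancelʳ-< x (<-respˡ-≈ (+-comm x z) (<-respʳ-≈ (+-comm x y) x+z<x+y)))
  ... | inj₂ x+y<w+y = w≤x (+-cancelʳ-< y x+y<w+y)

  <⇒0<- : ∀ {x y} → x < y → 0# < y - x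
  <⇒0<- {x} x<y = <-respˡ-≈ (-‿inverseʳ x) (+-monoˡ-< (- x) x<y)

  0<-⇒< : ∀ {x y} → 0# < y - x → x < y
  0<-⇒< {x} {y} 0<y-x = +-cancelʳ-< (- x) (<-respˡ-≈ (sym (-‿inverseʳ x)) 0<y-x)

  x<0⇒0<-x : ∀ {x} → x < 0# → 0# < - x
  x<0⇒0<-x {x} x<0 = <-respʳ-≈ (+-identityˡ (- x)) (<⇒0<- x<0)

  -- If `u` inverts `x * y`, then `u * x` inverts `y`.
  *-#⇒#ʳ : ∀ {x y} → x * y # 0# → y # 0#
  *-#⇒#ʳ {x} {y} xy#0 with #⇒invertible xy#0
  ... | u , u*xy≈1 , _ = invertibleˡ⇒# heytingCommutativeRing (u * x , (begin
    u * x * (y - 0#)   ≈⟨ *-congˡ (x-0≈x heytingCommutativeRing y) ⟩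
    u * x * y          ≈⟨ *-assoc u x y ⟩
    u * (x * y)        ≈⟨ *-congˡ (x-0≈x heytingCommutativeRing (x * y)) ⟨
    u * (x * y - 0#)   ≈⟨ u*xy≈1 ⟩
    1#                 ∎))

  -- A product apart from 0 has both factors apart from 0, so each factor has a definite sign and
  -- the wrong signs can be excluded.
  0≤⇒*-cancel-0< : ∀ {x y} → 0# ≤ x → 0# < x * y → 0# < y
  0≤⇒*-cancel-0< {x} {y} 0≤x 0<xy with #⇒<⊎> (*-#⇒#ʳ (0<⇒# 0<xy))
  ... | inj₂ 0<y = 0<y
  ... | inj₁ y<0 with #⇒<⊎> (*-#⇒#ʳ {y} (0<⇒# (<-respʳ-≈ (*-comm x y) 0<xy)))
  ...   | inj₁ x<0 = contradiction x<0 0≤x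
  ...   | inj₂ 0<x = contradiction
    (<-trans 0<xy (0<-⇒< (<-respʳ-≈ (trans (sym (-‿distribʳ-* x y)) (sym (+-identityˡ _)))
                                    (*-pos 0<x (x<0⇒0<-x y<0)))))
    (<-irrefl refl)

  -- There is no split into x = 0 and 0 < x. Instead the contrary assumption makes the product of
  -- `x` and `y - z` positive, and this alone forces `z < y`.
  *-monoˡ-≤ : ∀ {x y z} → 0# ≤ x → y ≤ z → x * y ≤ x * z
  *-monoˡ-≤ {x} {y} {z} 0≤x y≤z xz<xy =
    y≤z (0<-⇒< (0≤⇒*-cancel-0< 0≤x (<-respʳ-≈ (sym (x[y-z]≈xy-xz x y z)) (<⇒0<- xz<xy))))

  *-nonneg : ∀ {x y} → 0# ≤ x → 0# ≤ y → 0# ≤ x * y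
  *-nonneg {x} 0≤x 0≤y = ≤-respˡ (zeroʳ x) (*-monoˡ-≤ 0≤x 0≤y)

  0<1 : 0# < 1#
  0<1 with #⇒<⊎> (1#0 heytingCommutativeRing)
  ... | inj₂ 0<1 = 0<1
  ... | inj₁ 1<0 = <-respʳ-≈ -1*-1≈1 (*-pos (x<0⇒0<-x 1<0) (x<0⇒0<-x 1<0))
    where
    -1*-1≈1 : - 1# * - 1# ≈ 1#
    -1*-1≈1 = trans (sym (-‿distribˡ-* 1# (- 1#)))
                    (trans (-‿cong (*-identityˡ (- 1#))) (-‿involutive 1#))

  positive-· : ∀ m → 0# < suc m · 1#
  positive-· zero    = <-respʳ-≈ (sym (+-identityʳ 1#)) 0<1
  positive-· (suc m) = <-trans (positive-· m) (<-respˡ-≈ (+-identityˡ _) (+-monoˡ-< (suc m · 1#) 0<1))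

  fromℤ-⊖ : ∀ m n → fromℤ (m ⊖ n) ≈ m · 1# - n · 1#
  fromℤ-⊖ zero    zero    = sym (-‿inverseʳ 0#)
  fromℤ-⊖ zero    (suc n) = sym (+-identityˡ _)
  fromℤ-⊖ (suc m) zero    = sym (x-0≈x heytingCommutativeRing _)
  fromℤ-⊖ (suc m) (suc n) = begin
    fromℤ (suc m ⊖ suc n)               ≡⟨ ≡.cong fromℤ (ℤ.[1+m]⊖[1+n]≡m⊖n m n) ⟩
    fromℤ (m ⊖ n)                       ≈⟨ fromℤ-⊖ m n ⟩
    m · 1# - n · 1#                     ≈⟨ +-congʳ (trans (+-congʳ (-‿inverseʳ 1#)) (+-identityˡ _)) ⟨
    1# - 1# + m · 1# - n · 1#           ≈⟨ +-congʳ (trans (+-assoc 1# _ _)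
                                             (trans (+-congˡ (+-comm _ _)) (sym (+-assoc 1# _ _)))) ⟩
    1# + m · 1# - 1# - n · 1#           ≈⟨ +-assoc (1# + m · 1#) (- 1#) (- (n · 1#)) ⟩
    1# + m · 1# + (- 1# - n · 1#)       ≈⟨ +-congˡ (-‿+-comm 1# (n · 1#)) ⟩
    suc m · 1# - suc n · 1#             ∎

  fromℤ-+ : ∀ x y → fromℤ (x ℤ.+ y) ≈ fromℤ x + fromℤ y
  fromℤ-+ (+ m)    (+ n)    = ×-homo-+ 1# m n
  fromℤ-+ (+ m)    -[1+ n ] = fromℤ-⊖ m (suc n)
  fromℤ-+ -[1+ m ] (+ n)    = trans (fromℤ-⊖ n (suc m)) (+-comm _ _)
  fromℤ-+ -[1+ m ] -[1+ n ] = begin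
    - (suc (suc (m ℕ.+ n)) · 1#)     ≡⟨ ≡.cong (λ k → - (suc k · 1#)) (ℕ.+-suc m n) ⟨
    - ((suc m ℕ.+ suc n) · 1#)       ≈⟨ -‿cong (×-homo-+ 1# (suc m) (suc n)) ⟩
    - (suc m · 1# + suc n · 1#)      ≈⟨ -‿+-comm (suc m · 1#) (suc n · 1#) ⟨
    - (suc m · 1#) - suc n · 1#      ∎

  fromℤ-neg : ∀ x → fromℤ (ℤ.- x) ≈ - fromℤ x
  fromℤ-neg (+ zero)    = sym -0#≈0#
  fromℤ-neg (+ suc m)   = refl
  fromℤ-neg -[1+ m ]    = sym (-‿involutive _)

  fromℤ-- : ∀ x y → fromℤ (x ℤ.- y) ≈ fromℤ x - fromℤ y
  fromℤ-- x y = trans (fromℤ-+ x (ℤ.- y)) (+-congˡ (fromℤ-neg y))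

  fromℤ-1 : fromℤ 1ℤ ≈ 1#
  fromℤ-1 = +-identityʳ 1#

  fromℤ-*⁺ : ∀ m y → fromℤ (+ m ℤ.* y) ≈ m · 1# * fromℤ y
  fromℤ-*⁺ zero    y = sym (zeroˡ (fromℤ y))
  fromℤ-*⁺ (suc m) y = begin
    fromℤ (+ suc m ℤ.* y)              ≡⟨ ≡.cong fromℤ (ℤ.suc-* (+ m) y) ⟩
    fromℤ (y ℤ.+ + m ℤ.* y)            ≈⟨ fromℤ-+ y (+ m ℤ.* y) ⟩
    fromℤ y + fromℤ (+ m ℤ.* y)        ≈⟨ +-cong (sym (*-identityˡ _)) (fromℤ-*⁺ m y) ⟩
    1# * fromℤ y + m · 1# * fromℤ y    ≈⟨ distribʳ (fromℤ y) 1# (m · 1#) ⟨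
    suc m · 1# * fromℤ y               ∎

  fromℤ-* : ∀ x y → fromℤ (x ℤ.* y) ≈ fromℤ x * fromℤ y
  fromℤ-* (+ m)    y = fromℤ-*⁺ m y
  fromℤ-* -[1+ m ] y = begin
    fromℤ (-[1+ m ] ℤ.* y)        ≡⟨ ≡.cong fromℤ (ℤ.neg-distribˡ-* (+ suc m) y) ⟨
    fromℤ (ℤ.- (+ suc m ℤ.* y))   ≈⟨ fromℤ-neg (+ suc m ℤ.* y) ⟩
    - fromℤ (+ suc m ℤ.* y)       ≈⟨ -‿cong (fromℤ-*⁺ (suc m) y) ⟩
    - (suc m · 1# * fromℤ y)      ≈⟨ -‿distribˡ-* (suc m · 1#) (fromℤ y) ⟩
    - (suc m · 1#) * fromℤ y      ∎

  fromℤ-mono-< : ∀ {x y} → x ℤ.< y → fromℤ x < fromℤ y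
  fromℤ-mono-< {x} {y} x<y with y ℤ.- x in y-x≡
                              | ≡.subst (ℤ._< y ℤ.- x) (ℤ.+-inverseʳ x) (ℤ.+-monoˡ-< (ℤ.- x) x<y)
  ... | + suc m | ℤ.+<+ _ = 0<-⇒< (<-respʳ-≈
    (trans (reflexive (≡.cong fromℤ (≡.sym y-x≡))) (fromℤ-- y x)) (positive-· m))

  fromℤ-mono-≤ : ∀ {x y} → x ℤ.≤ y → fromℤ x ≤ fromℤ y
  fromℤ-mono-≤ {x} {y} x≤y with x ℤ.≟ y
  ... | yes ≡.refl = ≤-reflexive refl
  ... | no x≢y     = <⇒≤ (fromℤ-mono-< (ℤ.≤∧≢⇒< x≤y x≢y))

  -- The order of the integers is decidable, so the negative definition of `≤` on the field loses
  -- nothing here. Integer inequalities are recovered from the field in this way.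
  fromℤ-cancel-≤ : ∀ {x y} → fromℤ x ≤ fromℤ y → x ℤ.≤ y
  fromℤ-cancel-≤ fx≤fy = ℤ.≮⇒≥ (fx≤fy ∘ fromℤ-mono-<)

  fromℤ-injective : ∀ {x y} → fromℤ x ≈ fromℤ y → x ≡ y
  fromℤ-injective fx≈fy = ℤ.≤-antisym (fromℤ-cancel-≤ (≤-reflexive fx≈fy))
                                      (fromℤ-cancel-≤ (≤-reflexive (sym fx≈fy)))

-- Lattice points of the dilated polytope

module LatticePoints {a ℓ₁ ℓ₂ ℓ₃} (K : OrderedField a ℓ₁ ℓ₂ ℓ₃) where
  open OrderedField K hiding (zero)
  open FieldProperties K
  open Polytopes K using (fromℤ; combination; 𝒫; dilate; LatticePoint)
  open EdgeSums commutativeRing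
  open import Algebra.Properties.Semiring.Sum semiring using (sum)
  open import Algebra.Properties.CommutativeSemigroup
    (CommutativeRing.*-commutativeSemigroup commutativeRing) using (x∙yz≈y∙xz)
  open import Algebra.Properties.Ring ring using (-‿distribʳ-*)
  open import Relation.Binary.Reasoning.Setoid setoid

  single-nonneg : ∀ (e : Edge n) {x} → 0# ≤ x → ∀ e′ → 0# ≤ single e x e′
  single-nonneg e 0≤x e′ with does (e ≟ₑ e′)
  ... | true  = 0≤x
  ... | false = ≤-reflexive refl

  toEdges : (es : List (Edge n)) (c : Vector Carrier (length (map root es))) → (∀ s → 0# ≤ c s) →
            ∃ λ d → (∀ e → 0# ≤ d e) × (∀ {e} → e ∉ es → d e ≈ 0#) ×
                    (∀ v → combination c (List.lookup (map root es)) v ≈ comb d v) × sum c ≈ ∑ₑ d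
  toEdges [] c 0≤c =
    (λ _ → 0#) , (λ _ → ≤-reflexive refl) , (λ _ → refl) ,
    (λ v → sym (comb-zero v)) , sym (∑ₑ-of-zero λ _ → refl)
  toEdges (e ∷ es) c 0≤c with toEdges es (c ∘ suc) (0≤c ∘ suc)
  ... | d , 0≤d , supp , comb≈ , sum≈ =
    (λ e′ → single e (c zero) e′ + d e′) ,
    (λ e′ → ≤-respˡ (+-identityˡ 0#) (+-mono-≤ (single-nonneg e (0≤c zero) e′) (0≤d e′))) ,
    (λ {e′} e′∉ → trans (+-cong (reflexive (single-other {e = e} {e′} (c zero) (e′∉ ∘ here ∘ ≡.sym)))
                                (supp (e′∉ ∘ there)))
                        (+-identityˡ 0#)) ,
    (λ v → trans (+-cong (sym (⟪⟫-single e (c zero) (λ e → root e v))) (comb≈ v))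
                 (sym (⟪⟫-+ (single e (c zero)) d (λ e → root e v)))) ,
    trans (+-cong (sym (∑ₑ-of-single e (c zero))) sum≈) (sym (∑ₑ-+ (single e (c zero)) d))

  -- The first occurrence of an edge takes its whole coefficient and `rest` is 0 there, so a
  -- repeated edge is not counted twice.
  fromEdges : (es : List (Edge n)) (d : Edge n → Carrier) →
              (∀ e → 0# ≤ d e) → (∀ {e} → e ∉ es → d e ≈ 0#) →
              ∃ λ (c : Vector Carrier (length (map root es))) → (∀ s → 0# ≤ c s) ×
                (∀ v → combination c (List.lookup (map root es)) v ≈ comb d v) × sum c ≈ ∑ₑ d
  fromEdges [] d 0≤d supp =
    (λ ()) , (λ ()) , (λ v → sym (trans (⟪⟫-congˡ _ λ e → supp λ ()) (comb-zero v))) ,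
    sym (∑ₑ-of-zero λ e → supp λ ())
  fromEdges {n} (e ∷ es) d 0≤d supp with fromEdges es rest 0≤rest supp-rest
    where
    rest : Edge n → Carrier
    rest e′ = if does (e ≟ₑ e′) then 0# else d e′
    0≤rest : ∀ e′ → 0# ≤ rest e′
    0≤rest e′ with does (e ≟ₑ e′)
    ... | true  = ≤-reflexive refl
    ... | false = 0≤d e′
    supp-rest : ∀ {e′} → e′ ∉ es → rest e′ ≈ 0#
    supp-rest {e′} e′∉es with e ≟ₑ e′
    ... | yes _   = refl
    ... | no e≢e′ = supp λ { (here e′≡e) → e≢e′ (≡.sym e′≡e) ; (there e′∈es) → e′∉es e′∈es }
  ... | c , 0≤c , comb≈ , sum≈ =
    (λ { zero → d e ; (suc s) → c s }) , (λ { zero → 0≤d e ; (suc s) → 0≤c s }) ,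
    (λ v → trans (+-cong (sym (⟪⟫-single e (d e) (λ e → root e v))) (comb≈ v))
             (trans (sym (⟪⟫-+ (single e (d e)) _ (λ e → root e v))) (⟪⟫-congˡ (λ e → root e v) split))) ,
    trans (+-cong (sym (∑ₑ-of-single e (d e))) sum≈)
          (trans (sym (∑ₑ-+ (single e (d e)) _)) (∑ₑ-cong split))
    where
    split : ∀ e′ → single e (d e) e′ + (if does (e ≟ₑ e′) then 0# else d e′) ≈ d e′
    split e′ with e ≟ₑ e′
    ... | yes ≡.refl = +-identityʳ (d e)
    ... | no _       = +-identityˡ (d e′)

  fromℤ-∑ : ∀ {m} (g : Fin m → ℤ) → fromℤ (ℤ-Sums.∑ g) ≈ ∑ (fromℤ ∘ g)
  fromℤ-∑ g = begin
    fromℤ (ℤ-Sums.∑ g)   ≡⟨ ≡.cong fromℤ (ℤ-Sums.∑≡sum g) ⟩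
    fromℤ (sumℤ g) ≈⟨ go g ⟩
    sum (fromℤ ∘ g)      ≡⟨ ∑≡sum (fromℤ ∘ g) ⟨
    ∑ (fromℤ ∘ g)        ∎
    where
    go : ∀ {m} (g : Fin m → ℤ) → fromℤ (sumℤ g) ≈ sum (fromℤ ∘ g)
    go {zero}  g = refl
    go {suc m} g = trans (fromℤ-+ (g zero) (sumℤ (g ∘ suc))) (+-congˡ (go (g ∘ suc)))

  fromℤ-∑ₑ : (g : Edge n → ℤ) → fromℤ (ℤ-Sums.∑ₑ g) ≈ ∑ₑ (fromℤ ∘ g)
  fromℤ-∑ₑ g = begin
    fromℤ (ℤ-Sums.∑ₑ g)
      ≡⟨ ≡.cong fromℤ (ℤ-Sums.∑ₑ≡∑∑ g) ⟩
    fromℤ (ℤ-Sums.∑ λ a → ℤ-Sums.∑ λ b → g (a , b))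
      ≈⟨ trans (fromℤ-∑ (λ a → ℤ-Sums.∑ λ b → g (a , b)))
               (∑-cong λ a → fromℤ-∑ (λ b → g (a , b))) ⟩
    (∑ λ a → ∑ λ b → fromℤ (g (a , b)))
      ≡⟨ ∑ₑ≡∑∑ (fromℤ ∘ g) ⟨
    ∑ₑ (fromℤ ∘ g) ∎

  fromℤ-⟪⟫ : (c g : Edge n → ℤ) → fromℤ (ℤ-Sums.⟪ c , g ⟫) ≈ ⟪ fromℤ ∘ c , fromℤ ∘ g ⟫
  fromℤ-⟪⟫ c g = begin
    fromℤ (ℤ-Sums.⟪ c , g ⟫)                 ≡⟨ ≡.cong fromℤ (ℤ-Sums.⟪⟫≡∑ₑ c g) ⟩
    fromℤ (ℤ-Sums.∑ₑ λ e → c e ℤ.* g e)      ≈⟨ fromℤ-∑ₑ (λ e → c e ℤ.* g e) ⟩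
    ∑ₑ (λ e → fromℤ (c e ℤ.* g e))           ≈⟨ ∑ₑ-cong (λ e → fromℤ-* (c e) (g e)) ⟩
    ∑ₑ (λ e → fromℤ (c e) * fromℤ (g e))     ≡⟨ ⟪⟫≡∑ₑ (fromℤ ∘ c) (fromℤ ∘ g) ⟨
    ⟪ fromℤ ∘ c , fromℤ ∘ g ⟫                ∎

  fromℤ-indicator : ∀ b → fromℤ (if b then 1ℤ else 0ℤ) ≈ (if b then 1# else 0#)
  fromℤ-indicator true  = fromℤ-1
  fromℤ-indicator false = refl

  fromℤ-single : ∀ (e e′ : Edge n) → fromℤ (ℤ-Sums.single e 1ℤ e′) ≈ single e 1# e′
  fromℤ-single e e′ = fromℤ-indicator (does (e ≟ₑ e′))

  fromℤ-root : ∀ (e : Edge n) v → fromℤ (ℤ-Sums.root e v) ≈ root e v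
  fromℤ-root (i , j) v = trans (fromℤ-- (ℤ-Sums.basis i v) (ℤ-Sums.basis j v))
    (+-cong (fromℤ-indicator (does (i Fin.≟ v))) (-‿cong (fromℤ-indicator (does (j Fin.≟ v)))))

  fromℤ-comb : ∀ (c : Edge n → ℤ) v → fromℤ (ℤ-Sums.comb c v) ≈ comb (fromℤ ∘ c) v
  fromℤ-comb c v = trans (fromℤ-⟪⟫ c (λ e → ℤ-Sums.root e v)) (⟪⟫-cong λ e → *-congˡ (fromℤ-root e v))

  module _ {t : ℕ} {z : Vec ℤ (suc n)} {x : Vertex n → Carrier}
           (z≈tx : ∀ v → fromℤ (Vec.lookup z v) ≈ fromℤ (+ t) * x v) where

    pair-scaled : (d : Edge n → Carrier) → (∀ v → x v ≈ comb d v) → (φ : Vertex n → ℤ) →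
                  fromℤ (pair φ z) ≈ fromℤ (+ t) * ⟪ d , fromℤ ∘ ℤ-Sums.∂ φ ⟫
    pair-scaled d x≈ φ = begin
      fromℤ (pair φ z)
        ≈⟨ fromℤ-∑ (λ v → φ v ℤ.* Vec.lookup z v) ⟩
      ∑ (λ v → fromℤ (φ v ℤ.* Vec.lookup z v))
        ≈⟨ ∑-cong (λ v → trans (fromℤ-* (φ v) (Vec.lookup z v))
             (trans (*-congˡ (trans (z≈tx v) (*-congˡ (x≈ v))))
                    (x∙yz≈y∙xz (fromℤ (φ v)) T (comb d v)))) ⟩
      ∑ (λ v → T * (fromℤ (φ v) * comb d v))
        ≈⟨ *-∑ T (λ v → fromℤ (φ v) * comb d v) ⟨
      T * ∑ (λ v → fromℤ (φ v) * comb d v)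
        ≈⟨ *-congˡ (trans (∑-comb (fromℤ ∘ φ) d)
             (⟪⟫-cong λ (i , j) → *-congˡ (sym (fromℤ-- (φ i) (φ j))))) ⟩
      T * ⟪ d , fromℤ ∘ ℤ-Sums.∂ φ ⟫ ∎
      where T = fromℤ (+ t)

    -- The estimate of `bounded⇒within`, made over the field; both ends of the resulting inequality
    -- are integers, so it descends.
    hull⇒within : (d : Edge n → Carrier) → (∀ v → x v ≈ comb d v) →
                  (∀ e → 0# ≤ d e) → ∑ₑ d ≤ 1# → Within t z
    hull⇒within d x≈ 0≤d ∑d≤1 χ = fromℤ-cancel-≤
      (≤-respˡ (sym (pair-scaled d x≈ φ))
        (≤-respʳ (*-identityʳ (fromℤ (+ t)))
          (*-monoˡ-≤ (fromℤ-mono-≤ {0ℤ} {+ t} (ℤ.+≤+ ℕ.z≤n)) (≤-trans ⟪⟫≤∑ ∑d≤1))))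
      where
      φ : Vertex n → ℤ
      φ v = if χ v then 1ℤ else 0ℤ
      ⟪⟫≤∑ : ⟪ d , fromℤ ∘ ℤ-Sums.∂ φ ⟫ ≤ ∑ₑ d
      ⟪⟫≤∑ = ≤-respˡ (sym (reflexive (⟪⟫≡∑ₑ d _))) (∑ₑ-mono _≤_ (≤-reflexive refl) +-mono-≤ λ e →
        ≤-respʳ (trans (*-congˡ fromℤ-1) (*-identityʳ (d e)))
                (*-monoˡ-≤ (0≤d e) (fromℤ-mono-≤ (∂-indicator≤1 χ e))))

    -- Unimodularity: `T * d e` is the value at the integral point `z` of the integral functional
    -- given by a potential of the indicator of `e`, hence an integer.
    cone⇒decomposition : (F : Graph n) → Acyclic (E F) →
      (d : Edge n → Carrier) → (∀ v → x v ≈ comb d v) →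
      (∀ e → 0# ≤ d e) → (∀ {e} → ¬ E F e → d e ≈ 0#) →
      Decomposition (E F) z
    cone⇒decomposition F acyclic d x≈ 0≤d supp = record
      { coeff   = c
      ; nonneg  = λ e → fromℤ-cancel-≤ {0ℤ} (≤-respʳ (sym (c≈ e)) (*-nonneg 0≤T (0≤d e)))
      ; support = λ {e} e∉F → fromℤ-injective (trans (c≈ e) (trans (*-congˡ (supp e∉F)) (zeroʳ T)))
      ; expand  = λ v → fromℤ-injective (begin
          fromℤ (Vec.lookup z v)          ≈⟨ trans (z≈tx v) (*-congˡ (x≈ v)) ⟩
          T * comb d v                    ≈⟨ ⟪⟫-* T d (λ e → root e v) ⟨
          comb (λ e → T * d e) v          ≈⟨ ⟪⟫-congˡ (λ e → root e v) (λ e → sym (c≈ e)) ⟩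
          comb (fromℤ ∘ c) v              ≈⟨ fromℤ-comb c v ⟨
          fromℤ (ℤ-Sums.comb c v)         ∎)
      }
      where
      T = fromℤ (+ t)
      0≤T : 0# ≤ T
      0≤T = fromℤ-mono-≤ {0ℤ} {+ t} (ℤ.+≤+ ℕ.z≤n)
      φ : Edge n → Vertex n → ℤ
      φ e = proj₁ (acyclic (ℤ-Sums.single e 1ℤ))
      ∂φ : ∀ e {e′} → E F e′ → ℤ-Sums.∂ (φ e) e′ ≡ ℤ-Sums.single e 1ℤ e′
      ∂φ e = proj₂ (acyclic (ℤ-Sums.single e 1ℤ))
      c : Edge n → ℤ
      c e = pair (φ e) z
      c≈ : ∀ e → fromℤ (c e) ≈ T * d e
      c≈ e = trans (pair-scaled d x≈ (φ e)) (*-congˡ (trans (⟪⟫-cong agree) (⟪⟫-singleʳ d e)))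
        where
        agree : ∀ e′ → d e′ * fromℤ (ℤ-Sums.∂ (φ e) e′) ≈ d e′ * single e 1# e′
        agree e′ with E? F e′
        ... | yes e′∈F = *-congˡ (trans (reflexive (≡.cong fromℤ (∂φ e e′∈F))) (fromℤ-single e e′))
        ... | no  e′∉F = trans (*-congʳ (supp e′∉F))
          (trans (zeroˡ _) (sym (trans (*-congʳ (supp e′∉F)) (zeroˡ _))))

  latticePoint⇒latticeSet : (F : Graph n) → Acyclic (E F) → ∀ {t z} →
                            LatticePoint (dilate t (𝒫 F)) z → LatticeSet F t z
  latticePoint⇒latticeSet {n} F acyclic {t} {z}
    (x , ((h , 0≤h , sum-h≈1 , x≈h) , (c , 0≤c , x≈c)) , z≈tx)
    -- Index 0 of the hull is the origin, which adds nothing to the point; without its weight the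
    -- sum is at most 1.
    with toEdges (edges (complete n)) (h ∘ suc) (0≤h ∘ suc) | toEdges (edges F) c 0≤c
  ... | d , 0≤d , _ , comb-d≈ , sum-d≈ | d′ , 0≤d′ , supp′ , comb-d′≈ , _ =
    cone⇒decomposition {t = t} {z} z≈tx F acyclic d′
      (λ v → trans (x≈c v) (comb-d′≈ v)) 0≤d′ (λ e∉F → supp′ (e∉F ∘ ∈-edges⁻ F)) ,
    hull⇒within {t = t} {z} z≈tx d
      (λ v → trans (x≈h v) (trans (+-congʳ (zeroʳ (h zero))) (trans (+-identityˡ _) (comb-d≈ v)))) 0≤d
      (≤-respˡ sum-d≈ (≤-respʳ sum-h≈1 (≤-respˡ (+-identityˡ _) (+-mono-≤ (0≤h zero) (≤-reflexive refl)))))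

  inverse : ∀ t → ∃ λ u → 0# ≤ u × fromℤ (+ suc t) * u ≈ 1#
  inverse t with #⇒invertible (0<⇒# (positive-· t))
  ... | u , _ , Tu≈1 = u , 0≤u , Tu≈1′
    where
    T = fromℤ (+ suc t)
    Tu≈1′ : T * u ≈ 1#
    Tu≈1′ = trans (*-congʳ (sym (x-0≈x heytingCommutativeRing T))) Tu≈1
    0≤u : 0# ≤ u
    0≤u u<0 = <-irrefl refl (<-trans 0<1 (0<-⇒< (<-respʳ-≈
      (trans (sym (-‿distribʳ-* T u)) (trans (-‿cong Tu≈1′) (sym (+-identityˡ _))))
      (*-pos (positive-· t) (x<0⇒0<-x u<0)))))

  -- For t = 0 the scale is 0, since then the only lattice point is the origin.
  scale : ∀ {P : Edge n → Set} t {z} → Bounded P t z →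
          ∃ λ u → 0# ≤ u × fromℤ (+ t) * u ≤ 1# ×
                  (∀ v → fromℤ (Vec.lookup z v) ≈ fromℤ (+ t) * (u * fromℤ (Vec.lookup z v)))
  scale (suc t) _ =
    let u , 0≤u , Tu≈1 = inverse t
    in u , 0≤u , ≤-reflexive Tu≈1 ,
       λ v → sym (trans (sym (*-assoc _ u _)) (trans (*-congʳ Tu≈1) (*-identityˡ _)))
  scale zero {z} (D , total≤0) =
    0# , ≤-reflexive refl , ≤-respˡ (sym (zeroˡ 0#)) (<⇒≤ 0<1) ,
    λ v → trans (reflexive (≡.cong fromℤ (vanish v))) (sym (zeroˡ _))
    where
    vanish : ∀ v → Vec.lookup z v ≡ 0ℤ
    vanish v = ≡.trans (expand D v) (≡.trans
      (ℤ-Sums.⟪⟫-congˡ (λ e → ℤ-Sums.root e v) λ e →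
        ℤ.≤-antisym (ℤ.≤-trans (coeff≤total D e) total≤0) (nonneg D e))
      (ℤ-Sums.comb-zero v))

  -- Two decompositions of the same `z` are scaled: the one from `short`, with bounded sum over the
  -- complete graph, gives the hull, and the one over `F` gives the cone.
  latticeSet⇒latticePoint : {F : Graph n} → STree F → ∀ {t z} →
                            LatticeSet F t z → LatticePoint (dilate t (𝒫 F)) z
  latticeSet⇒latticePoint {n} {F} tree {t} {z} z∈ with short tree z∈
  ... | D′ , total≤t with scale t (D′ , total≤t)
  ... | u , 0≤u , Tu≤1 , z≈Tuz
    with fromEdges (edges (complete n)) (scaled D′) (scaled-nonneg D′)
           (λ e∉ → scaled-support D′ (e∉ ∘ ∈-edges⁺ (complete n)))
       | fromEdges (edges F) (scaled (proj₁ z∈)) (scaled-nonneg (proj₁ z∈))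
           (λ e∉ → scaled-support (proj₁ z∈) (e∉ ∘ ∈-edges⁺ F))
    where
    scaled : ∀ {P : Edge n → Set} → Decomposition P z → Edge n → Carrier
    scaled D e = u * fromℤ (coeff D e)
    scaled-nonneg : ∀ {P : Edge n → Set} (D : Decomposition P z) e → 0# ≤ scaled D e
    scaled-nonneg D e = *-nonneg 0≤u (fromℤ-mono-≤ (nonneg D e))
    scaled-support : ∀ {P : Edge n → Set} (D : Decomposition P z) {e} → ¬ P e → scaled D e ≈ 0#
    scaled-support D e∉ = trans (*-congˡ (reflexive (≡.cong fromℤ (support D e∉)))) (zeroʳ u)
  ... | h , 0≤h , comb-h≈ , sum-h≈ | c , 0≤c , comb-c≈ , _ =
    x , ((h₀ , 0≤h₀ , sum≈1 , λ v →
            trans (x≈ D′ v) (sym (trans (+-congʳ (zeroʳ _)) (trans (+-identityˡ _) (comb-h≈ v))))) ,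
         (c , 0≤c , λ v → trans (x≈ (proj₁ z∈) v) (sym (comb-c≈ v)))) ,
    z≈Tuz
    where
    x : Vertex n → Carrier
    x v = u * fromℤ (Vec.lookup z v)
    x≈ : ∀ {P : Edge n → Set} (D : Decomposition P z) v → x v ≈ comb (λ e → u * fromℤ (coeff D e)) v
    x≈ D v = trans (*-congˡ (trans (reflexive (≡.cong fromℤ (expand D v))) (fromℤ-comb (coeff D) v)))
                   (sym (⟪⟫-* u (fromℤ ∘ coeff D) (λ e → root e v)))
    sum-h≤1 : sum h ≤ 1#
    sum-h≤1 = ≤-respˡ
      (sym (trans sum-h≈ (trans (sym (*-∑ₑ u (fromℤ ∘ coeff D′)))
                                (*-congˡ (sym (fromℤ-∑ₑ (coeff D′)))))))
      (≤-trans (*-monoˡ-≤ 0≤u (fromℤ-mono-≤ total≤t)) (≤-respˡ (*-comm _ u) Tu≤1))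
    -- The slack up to 1 is put on the origin.
    h₀ : Vector Carrier _
    h₀ zero    = 1# - sum h
    h₀ (suc s) = h s
    0≤h₀ : ∀ s → 0# ≤ h₀ s
    0≤h₀ zero    = ≤-respˡ (-‿inverseʳ (sum h)) (+-mono-≤ sum-h≤1 (≤-reflexive refl))
    0≤h₀ (suc s) = 0≤h s
    sum≈1 : sum h₀ ≈ 1#
    sum≈1 = trans (+-assoc 1# _ _) (trans (+-congˡ (-‿inverseˡ (sum h))) (+-identityʳ 1#))

open import Data.Integer.Base using (_*_; _^_)

theorem11 : ∀ {c ℓ₁ ℓ₂ ℓ₃} (K : OrderedField c ℓ₁ ℓ₂ ℓ₃)
    {n l : ℕ} (F : Graph n) → IsForest F → numEdges F ≡ l →
    (T : STree F) →
    Polytopes.HasEhrhartFunction K (Polytopes.𝒫 K F) (λ t →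
    -1ℤ ^ l * sumℤ (λ (i : Fin (suc l)) →
    -1ℤ ^ toℕ i * + f T (toℕ i) * + ((t +ₙ toℕ i) C toℕ i)))
theorem11 K F forest ≡.refl T t =
  let acyclic      = forest⇒acyclic F forest
      m , card , m≡ = card-tree T acyclic t
  in m ,
     card-resp-⇔ (λ z → mk⇔ (latticeSet⇒latticePoint T) (latticePoint⇒latticeSet F acyclic)) card ,
     ≡.trans m≡ (≡.cong (-1ℤ ^ numEdges F *_)
       (≡.trans (ForestCount.signedCount-count isForest? t (leaves T) (leaves-bounded T acyclic))
                (ℤ-Sums.∑≡sum _)))
  where open LatticePoints K
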